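{- For every integer $m\ge 2$, $\pi_f(K_{m+1,m,m})=\frac{6m}{2m+1}$.
   Context: $K_{a,b,c}$ is the complete tripartite graph with parts of sizes $a,b,c$. Two edges are nonincident if they share no endpoint. A linear ordering of $V(G)$ separates a pair of nonincident edges if both endpoints of one edge precede both endpoints of the other. $\pi_t(G)$ is the minimum length of a list of linear orderings of $V(G)$ (repetitions allowed) separating every pair of nonincident edges at least $t$ times, and the fractional separation dimension is $\pi_f(G)=\liminf_{t\to\infty}\pi_t(G)/t$. -}

module Defs where

open import Data.Nat using (ℕ; zero; suc; _+_; _*_; _≤_; _<ᵇ_)
open import Data.Bool using (Bool; true; false; _∧_; _∨_; if_then_else_)
open import Data.Fin using (Fin; toℕ; splitAt)
open import Data.Fin.Permutation using (Permutation′; _⟨$⟩ʳ_)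
open import Data.Sum using (_⊎_; inj₁; inj₂)
open import Data.List using (List; []; _∷_; length)
open import Data.Product using (Σ; ∃; _×_; _,_)
open import Relation.Binary.PropositionalEquality using (_≡_; _≢_)
open import Data.Integer using (+_)
open import Data.Rational using (ℚ; _/_; 0ℚ)

-- Vertex set of K_{a,b,c}: Fin (a + b + c); the first a vertices form part 0,
-- the next b part 1, the last c part 2.
part : (a b c : ℕ) → Fin (a + b + c) → ℕ
part a b c v with splitAt (a + b) v
... | inj₂ _ = 2
... | inj₁ w with splitAt a w
...   | inj₁ _ = 0
...   | inj₂ _ = 1

IsEdge : (a b c : ℕ) → Fin (a + b + c) → Fin (a + b + c) → Set
IsEdge a b c u v = part a b c u ≢ part a b c v

Nonincident : {n : ℕ} → (u v x y : Fin n) → Set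
Nonincident u v x y = (u ≢ x) × (u ≢ y) × (v ≢ x) × (v ≢ y)

-- A linear ordering of the vertex set Fin n is a permutation σ;
-- vertex w is at position σ(w).
pos : {n : ℕ} → Permutation′ n → Fin n → ℕ
pos σ w = toℕ (σ ⟨$⟩ʳ w)

precedes : {n : ℕ} → Permutation′ n → (u v x y : Fin n) → Bool
precedes σ u v x y =
  (pos σ u <ᵇ pos σ x) ∧ (pos σ u <ᵇ pos σ y) ∧ (pos σ v <ᵇ pos σ x) ∧ (pos σ v <ᵇ pos σ y)

separates : {n : ℕ} → Permutation′ n → (u v x y : Fin n) → Bool
separates σ u v x y = precedes σ u v x y ∨ precedes σ x y u v

countSep : {n : ℕ} → List (Permutation′ n) → (u v x y : Fin n) → ℕ
countSep [] u v x y = 0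
countSep (σ ∷ L) u v x y =
  (if separates σ u v x y then 1 else 0) + countSep L u v x y

TSeparating : (a b c t : ℕ) → List (Permutation′ (a + b + c)) → Set
TSeparating a b c t L =
  ∀ u v x y → IsEdge a b c u v → IsEdge a b c x y → Nonincident u v x y →
  t ≤ countSep L u v x y

-- There is a list of exactly k orderings (repetitions allowed) which t-separates.
-- π_t(K_{a,b,c}) is the least k such that CanSep a b c t k holds.
CanSep : (a b c t k : ℕ) → Set
CanSep a b c t k = Σ (List (Permutation′ (a + b + c))) λ L →
  (length L ≡ k) × TSeparating a b c t L

-- k / t as a rational (t ≥ 1 in all uses; 0 for t = 0)
ratio : ℕ → ℕ → ℚ
ratio k zero = 0ℚ
ratio k (suc t) = (+ k) / suc t

{-# OPTIONS --safe #-}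

-- Lower bound: already in K_{m,m,m}, consider the pairs of nonincident edges {xy, x′z} with x, x′ in
-- one part and y, z in the two others.  Read an ordering as a word with m letters A, m letters B and
-- m letters C.  While it is read, the number of separated pairs gained is bounded by the decrease of
-- a polynomial potential of the numbers of letters still to come: at a letter X the difference is a
-- multiple of d (d − 1) + e (e − 1), where the other two letters have d and e more occurrences left
-- than X.  So an ordering separates at most m² (m − 1) (2m + 1) / 2 of the 3 m³ (m − 1) pairs, and
-- averaging gives 6m / (2m + 1).
--
-- Upper bound: take the word (ABC)^m A and label its letters by the vertices of the parts in all
-- (m + 1)! m! m! ways.  By symmetry the number of times a pair is separated depends only on the type
-- of the pair, and summing over all pairs of a type reduces it to a polynomial identity in m.

module Submission where

open import Defs
open import Data.Nat using (ℕ; zero; suc; _+_; _*_; _≤_; _≥_; _<ᵇ_; _!; z≤n; s≤s)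
open import Data.Nat.Properties hiding (suc-injective)
open import Data.Nat.Tactic.RingSolver using (solve-∀)
open import Data.Bool using (Bool; true; false; _∧_; _∨_; if_then_else_)
open import Data.Bool.Properties using (∧-zeroʳ; ∨-comm)
open import Data.Fin using (Fin; zero; suc; toℕ; punchIn; splitAt; join; _↑ˡ_; _↑ʳ_)
open import Data.Fin.Properties as Fin using (splitAt-↑ˡ; splitAt-↑ʳ; join-splitAt; ↑ˡ-injective; ↑ʳ-injective; punchInᵢ≢i; toℕ-cast; +↔⊎)
open import Data.Fin.Permutation using (Permutation′; _⟨$⟩ʳ_; _⟨$⟩ˡ_; flip; inverseʳ; insert; insert-punchIn; cast-id) renaming (id to idₚ)
open import Data.Integer as ℤ using (ℤ; +_; -[1+_])
import Data.Integer.Properties as ℤ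
import Data.Integer.Tactic.RingSolver as ℤ-Ring
import Data.Nat.Tactic.RingSolver as ℕ-Ring
open import Data.List using (List; []; _∷_; _++_; map; concat; concatMap; replicate; allFin; tabulate; length)
open import Data.List.Properties using (length-++)
open import Data.Maybe using (Maybe; just; nothing)
open import Data.Product using (Σ; _×_; _,_)
open import Data.Rational using (ℚ; _/_; 0ℚ; _<_; toℚᵘ) renaming (_≤_ to _≤ℚ_; _+_ to _+ℚ_; _-_ to _-ℚ_)
import Data.Rational.Properties as ℚ
open import Data.Rational.Unnormalised using (mkℚᵘ; *≤*)
import Data.Rational.Unnormalised.Properties as ℚᵘ
open import Data.Sum as Sum using (_⊎_; inj₁; inj₂; [_,_]′)
open import Data.Sum.Function.Propositional using (_⊎-↔_)
open import Function using (_∘_; id; const; _↔_; mk↔ₛ′; Inverse)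
open import Function.Properties.Inverse using (↔-trans; ↔-refl)
open import Relation.Binary.PropositionalEquality
open import Relation.Nullary using (contradiction)
open import Algebra.Properties.Semiring.Sum +-*-semiring using (sum; sum-cong-≗; sum-remove; ∑-distrib-+; ∑-comm; sum-permute; *-distribˡ-sum; *-distribʳ-sum; sum-replicate-zero)
open import Tactic.RingSolver.Core.Expression using (Expr; Κ; _⊕_; _⊗_; ⊝_)
import Tactic.RingSolver.NonReflective ℤ-Ring.ring as ℤ-Expr
import Tactic.RingSolver.NonReflective ℕ-Ring.ring as ℕ-Expr

-- Rational estimates

-- The lower bound counts only pairs of edges that meet all three parts because these are the tight
-- ones. In the orderings labelling (ABC)^m A, each of the types AB-AC, AB-BC and AC-BC is separated
-- with frequency exactly (2m + 1)/(6m), whereas the types on two parts, such as AB-AB, reach (2m +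
-- 2)/(6m).
--
-- The excess d(d - 1) + e(e - 1) vanishes exactly when d and e are 0 or 1. This holds at every
-- letter of (ABC)^m, so the potential loses nothing on that word: the total of the three tight
-- types is then optimal. The total alone does not suffice, since every single pair must be
-- separated often enough: for m = 2 the word (ABC)^m separates 3, 4 and 3 pairs of the types AB-AC,
-- AB-BC and AC-BC, out of 8 each. The additional letter A makes the three frequencies equal, and
-- this is why the larger part has m + 1 vertices.
--
-- For the limit inferior, the lower bound holds for every t, and the value itself is attained for
-- arbitrarily large t.

/-mono-≤ : ∀ a b c d → a * suc d ≤ c * suc b → (+ a) / suc b ≤ℚ (+ c) / suc d
/-mono-≤ a b c d ad≤cb = ℚ.toℚᵘ-cancel-≤ (begin
  toℚᵘ ((+ a) / suc b) ≃⟨ ℚ.toℚᵘ-fromℚᵘ (mkℚᵘ (+ a) b) ⟩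
  mkℚᵘ (+ a) b                    ≤⟨ *≤*
      (subst₂ ℤ._≤_ (ℤ.pos-* a (suc d)) (ℤ.pos-* c (suc b)) (ℤ.+≤+ ad≤cb)) ⟩
  mkℚᵘ (+ c) d                    ≃⟨ ℚ.toℚᵘ-fromℚᵘ (mkℚᵘ (+ c) d) ⟨
  toℚᵘ ((+ c) / suc d) ∎)
  where open ℚᵘ.≤-Reasoning

ratio-≥ : ∀ a b k t → t ≥ 1 → a * t ≤ k * suc b → (+ a) / suc b ≤ℚ ratio k t
ratio-≥ a b k (suc t) _ = /-mono-≤ a b k t

ratio-≤ : ∀ a b k t → t ≥ 1 → k * suc b ≤ a * t → ratio k t ≤ℚ (+ a) / suc b
ratio-≤ a b k (suc t) _ = /-mono-≤ k t a b

p-ε≤p : ∀ p ε → 0ℚ < ε → p -ℚ ε ≤ℚ p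
p-ε≤p p ε 0<ε = subst (p -ℚ ε ≤ℚ_) (ℚ.+-identityʳ p) (ℚ.+-monoʳ-≤ p (ℚ.neg-antimono-≤ (ℚ.<⇒≤ 0<ε)))

p≤p+ε : ∀ p ε → 0ℚ < ε → p ≤ℚ p +ℚ ε
p≤p+ε p ε 0<ε = subst (_≤ℚ p +ℚ ε) (ℚ.+-identityʳ p) (ℚ.+-monoʳ-≤ p (ℚ.<⇒≤ 0<ε))

-- The potential

-- p, q, r are the numbers of letters A, B, C still to come; 12 times the number of separated pairs
-- gained from there on is at most the potential.  It is obtained by summing potential-step.
potential : ℤ → ℤ → ℤ → ℤ → ℤ
potential m p q r =
  + 12 ℤ.* (p ℤ.* q ℤ.* r) ℤ.* (+ 1 ℤ.+ + 2 ℤ.* m ℤ.- p ℤ.- q ℤ.- r)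
  ℤ.+ m ℤ.* (+ 2 ℤ.* (p ℤ.* p ℤ.* p ℤ.+ q ℤ.* q ℤ.* q ℤ.+ r ℤ.* r ℤ.* r ℤ.- p ℤ.- q ℤ.- r)
    ℤ.+ + 3 ℤ.* (p ℤ.* q ℤ.* (p ℤ.+ q ℤ.- + 2) ℤ.+ p ℤ.* r ℤ.* (p ℤ.+ r ℤ.- + 2)
      ℤ.+ q ℤ.* r ℤ.* (q ℤ.+ r ℤ.- + 2)))

-- The same polynomial as syntax for the ring solver.
potentialᴱ : ∀ {n} → Expr ℤ n → Expr ℤ n → Expr ℤ n → Expr ℤ n → Expr ℤ n
potentialᴱ m p q r =
  Κ (+ 12) ⊗ (p ⊗ q ⊗ r) ⊗ (Κ (+ 1) ⊕ Κ (+ 2) ⊗ m ⊕ ⊝ p ⊕ ⊝ q ⊕ ⊝ r)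
  ⊕ m ⊗ (Κ (+ 2) ⊗ (p ⊗ p ⊗ p ⊕ q ⊗ q ⊗ q ⊕ r ⊗ r ⊗ r ⊕ ⊝ p ⊕ ⊝ q ⊕ ⊝ r)
    ⊕ Κ (+ 3) ⊗ (p ⊗ q ⊗ (p ⊕ q ⊕ ⊝ Κ (+ 2)) ⊕ p ⊗ r ⊗ (p ⊕ r ⊕ ⊝ Κ (+ 2))
      ⊕ q ⊗ r ⊗ (q ⊕ r ⊕ ⊝ Κ (+ 2))))

-- The symmetry in the three letters lets the step be analysed for the letter A alone.
potential-swap : ∀ m p q r → potential m p q r ≡ potential m q p r
potential-swap = ℤ-Expr.solve 4 (λ m p q r → potentialᴱ m p q r , potentialᴱ m q p r) refl

potential-rotate : ∀ m p q r → potential m p q r ≡ potential m r p q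
potential-rotate = ℤ-Expr.solve 4 (λ m p q r → potentialᴱ m p q r , potentialᴱ m r p q) refl

-- Before the current A, `m - q` letters B and `m - r` letters C have been read. Each such B forms
-- an edge with this A, which precedes `p * r` edges AC and `q * r` edges BC; likewise for each C.
-- The first term is 12 times this count, the last one is the excess with d = `q - p` and e =
-- `r - p`.
potential-step : ∀ m p q r → potential m (+ 1 ℤ.+ p) q r ≡
  + 12 ℤ.* ((m ℤ.- q) ℤ.* (r ℤ.* (p ℤ.+ q)) ℤ.+ (m ℤ.- r) ℤ.* (q ℤ.* (p ℤ.+ r)))
  ℤ.+ potential m p q r
  ℤ.+ + 3 ℤ.* m ℤ.* ((q ℤ.- p) ℤ.* (q ℤ.- p ℤ.- + 1) ℤ.+ (r ℤ.- p) ℤ.* (r ℤ.- p ℤ.- + 1))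
potential-step = ℤ-Expr.solve 4 (λ m p q r →
  potentialᴱ m (Κ (+ 1) ⊕ p) q r ,
  Κ (+ 12) ⊗ ((m ⊕ ⊝ q) ⊗ (r ⊗ (p ⊕ q)) ⊕ (m ⊕ ⊝ r) ⊗ (q ⊗ (p ⊕ r)))
  ⊕ potentialᴱ m p q r
  ⊕ Κ (+ 3) ⊗ m ⊗ ((q ⊕ ⊝ p) ⊗ (q ⊕ ⊝ p ⊕ ⊝ Κ (+ 1)) ⊕ (r ⊕ ⊝ p) ⊗ (r ⊕ ⊝ p ⊕ ⊝ Κ (+ 1)))) refl

potential-initial : ∀ n → let m = suc n in
  potential (+ m) (+ m) (+ m) (+ m) ≡ + (6 * (m * m * n * suc (2 * m)))
potential-initial n = trans (expand (+ n)) (sym cast)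
  where
  m = suc n
  expand : ∀ n → potential (+ 1 ℤ.+ n) (+ 1 ℤ.+ n) (+ 1 ℤ.+ n) (+ 1 ℤ.+ n)
    ≡ + 6 ℤ.* ((+ 1 ℤ.+ n) ℤ.* (+ 1 ℤ.+ n) ℤ.* n ℤ.* (+ 1 ℤ.+ + 2 ℤ.* (+ 1 ℤ.+ n)))
  expand = ℤ-Expr.solve 1 (λ n → let m = Κ (+ 1) ⊕ n in
    potentialᴱ m m m m , Κ (+ 6) ⊗ (m ⊗ m ⊗ n ⊗ (Κ (+ 1) ⊕ Κ (+ 2) ⊗ m))) refl
  cast : + (6 * (m * m * n * suc (2 * m))) ≡
    + 6 ℤ.* (+ m ℤ.* + m ℤ.* + n ℤ.* (+ 1 ℤ.+ + 2 ℤ.* + m))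
  cast = trans (ℤ.pos-* 6 (m * m * n * suc (2 * m))) (cong (ℤ._*_ (+ 6))
    (trans (ℤ.pos-* (m * m * n) (suc (2 * m)))
      (cong₂ ℤ._*_ (trans (ℤ.pos-* (m * m) n) (cong (ℤ._* + n) (ℤ.pos-* m m)))
        (cong (ℤ._+_ (+ 1)) (ℤ.pos-* 2 m)))))

-- Two consecutive integers never have opposite signs. A real number strictly between 0 and 1 would
-- violate this, so the estimate rests on the counts being integers.
0≤i*[i-1] : ∀ i → + 0 ℤ.≤ i ℤ.* (i ℤ.- + 1)
0≤i*[i-1] (+ zero)  = ℤ.≤-refl
0≤i*[i-1] (+ suc n) = subst (+ 0 ℤ.≤_) (ℤ.pos-* (suc n) n) (ℤ.+≤+ z≤n)
0≤i*[i-1] -[1+ n ]  = ℤ.+≤+ z≤n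

-- `β` and `γ` count the letters B and C already read. The equations with `m` express them by what
-- is left, so that the state of the scan is `p`, `q`, `r` alone; the inequality is `potential-step`
-- without its nonnegative excess.
advance : ∀ m p q r β γ g x → g ≡ β * (r * (p + q)) + γ * (q * (p + r)) →
  β + q ≡ m → γ + r ≡ m →
  + 12 ℤ.* + x ℤ.≤ potential (+ m) (+ p) (+ q) (+ r) →
  + 12 ℤ.* + (g + x) ℤ.≤ potential (+ m) (+ suc p) (+ q) (+ r)
advance m p q r β γ g x g≡ β+q≡m γ+r≡m x≤ = begin
  + 12 ℤ.* (+ g ℤ.+ + x)
    ≡⟨ ℤ.*-distribˡ-+ (+ 12) (+ g) (+ x) ⟩
  + 12 ℤ.* + g ℤ.+ + 12 ℤ.* + x
    ≤⟨ ℤ.+-monoʳ-≤ (+ 12 ℤ.* + g) x≤ ⟩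
  + 12 ℤ.* + g ℤ.+ potential (+ m) (+ p) (+ q) (+ r)
    ≡⟨ cong (λ y → + 12 ℤ.* y ℤ.+ potential (+ m) (+ p) (+ q) (+ r)) +g≡ ⟩
  + 12 ℤ.* G ℤ.+ potential (+ m) (+ p) (+ q) (+ r)
    ≡⟨ ℤ.+-identityʳ _ ⟨
  + 12 ℤ.* G ℤ.+ potential (+ m) (+ p) (+ q) (+ r) ℤ.+ + 0
    ≤⟨ ℤ.+-monoʳ-≤ (+ 12 ℤ.* G ℤ.+ potential (+ m) (+ p) (+ q) (+ r)) excess≥0 ⟩
  + 12 ℤ.* G ℤ.+ potential (+ m) (+ p) (+ q) (+ r) ℤ.+ + 3 ℤ.* + m ℤ.* D
    ≡⟨ potential-step (+ m) (+ p) (+ q) (+ r) ⟨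
  potential (+ m) (+ suc p) (+ q) (+ r) ∎
  where
  open ℤ.≤-Reasoning
  G = (+ m ℤ.- + q) ℤ.* (+ r ℤ.* (+ p ℤ.+ + q)) ℤ.+ (+ m ℤ.- + r) ℤ.* (+ q ℤ.* (+ p ℤ.+ + r))
  D = (+ q ℤ.- + p) ℤ.* (+ q ℤ.- + p ℤ.- + 1) ℤ.+ (+ r ℤ.- + p) ℤ.* (+ r ℤ.- + p ℤ.- + 1)
  excess≥0 : + 0 ℤ.≤ + 3 ℤ.* + m ℤ.* D
  excess≥0 = subst₂ ℤ._≤_ (ℤ.*-zeroʳ (+ (3 * m))) (cong (ℤ._* D) (ℤ.pos-* 3 m))
    (ℤ.*-monoˡ-≤-nonNeg (+ (3 * m)) (ℤ.+-mono-≤ (0≤i*[i-1] (+ q ℤ.- + p)) (0≤i*[i-1] (+ r ℤ.- + p))))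
  cancel : ∀ i j → i ≡ (i ℤ.+ j) ℤ.- j
  cancel = ℤ-Ring.solve-∀
  term : ∀ δ u v w → δ + u ≡ m → + (δ * (v * w)) ≡ (+ m ℤ.- + u) ℤ.* (+ v ℤ.* + w)
  term δ u v w δ+u≡m = trans (ℤ.pos-* δ (v * w)) (cong₂ ℤ._*_
    (trans (cancel (+ δ) (+ u)) (cong (λ y → + y ℤ.- + u) δ+u≡m)) (ℤ.pos-* v w))
  +g≡ : + g ≡ G
  +g≡ = trans (cong +_ g≡) (cong₂ ℤ._+_ (term β q r (p + q) β+q≡m) (term γ r q (p + r) γ+r≡m))

open ≡-Reasoning

-- Counting quadruples of positions in a word

𝟙 : Bool → ℕ
𝟙 b = if b then 1 else 0

sum-zero : ∀ {n} (f : Fin n → ℕ) → (∀ i → f i ≡ 0) → sum f ≡ 0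
sum-zero {n} f f≡0 = trans (sum-cong-≗ f≡0) (sum-replicate-zero n)

sum₄ : ∀ {a b c d} → (Fin a → Fin b → Fin c → Fin d → ℕ) → ℕ
sum₄ F = sum λ p → sum λ q → sum λ r → sum λ s → F p q r s

sum₄-cong : ∀ {a b c d} {F G : Fin a → Fin b → Fin c → Fin d → ℕ} →
  (∀ p q r s → F p q r s ≡ G p q r s) → sum₄ F ≡ sum₄ G
sum₄-cong eq =
  sum-cong-≗ λ p → sum-cong-≗ λ q → sum-cong-≗ λ r → sum-cong-≗ λ s → eq p q r s

sum₄-+ : ∀ {a b c d} (F G : Fin a → Fin b → Fin c → Fin d → ℕ) →
  sum₄ (λ p q r s → F p q r s + G p q r s) ≡ sum₄ F + sum₄ G
sum₄-+ F G = trans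
  (sum-cong-≗ λ p → trans
    (sum-cong-≗ λ q → trans
      (sum-cong-≗ λ r → ∑-distrib-+ (F p q r) (G p q r))
      (∑-distrib-+ (λ r → sum (F p q r)) _))
    (∑-distrib-+ (λ q → sum λ r → sum (F p q r)) _))
  (∑-distrib-+ (λ p → sum λ q → sum λ r → sum (F p q r)) _)

∑-rotate : ∀ {a b c} (F : Fin a → Fin b → Fin c → ℕ) →
  (sum λ p → sum λ q → sum λ r → F p q r) ≡ (sum λ q → sum λ r → sum λ p → F p q r)
∑-rotate F = trans (∑-comm λ p q → sum (F p q)) (sum-cong-≗ λ q → ∑-comm λ p → F p q)

sum₄-swap : ∀ {a b c d} (F : Fin a → Fin b → Fin c → Fin d → ℕ) →
  sum₄ F ≡ sum₄ (λ r s p q → F p q r s)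
sum₄-swap F = begin
  sum₄ F
    ≡⟨ sum-cong-≗ (λ p → ∑-rotate (F p)) ⟩
  (sum λ p → sum λ r → sum λ s → sum λ q → F p q r s)
    ≡⟨ ∑-rotate (λ p r s → sum λ q → F p q r s) ⟩
  sum₄ (λ r s p q → F p q r s) ∎

before : (p q r s : ℕ) → Bool
before p q r s = (p <ᵇ r) ∧ (p <ᵇ s) ∧ (q <ᵇ r) ∧ (q <ᵇ s)

separated : (p q r s : ℕ) → Bool
separated p q r s = before p q r s ∨ before r s p q

<ᵇ-asym : ∀ p r → (p <ᵇ r) ∧ (r <ᵇ p) ≡ false
<ᵇ-asym zero    zero    = refl
<ᵇ-asym zero    (suc r) = refl
<ᵇ-asym (suc p) zero    = refl
<ᵇ-asym (suc p) (suc r) = <ᵇ-asym p r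

𝟙-∨ : ∀ a b {x y} → a ∧ b ≡ false → 𝟙 ((a ∧ x) ∨ (b ∧ y)) ≡ 𝟙 (a ∧ x) + 𝟙 (b ∧ y)
𝟙-∨ false b          eq = refl
𝟙-∨ true  false {false} eq = refl
𝟙-∨ true  false {true}  eq = refl

-- The two directions exclude each other already through `p` and `r`, so the disjunction is counted
-- by a sum.
𝟙-separated : ∀ p q r s → 𝟙 (separated p q r s) ≡ 𝟙 (before p q r s) + 𝟙 (before r s p q)
𝟙-separated p q r s = 𝟙-∨ (p <ᵇ r) (r <ᵇ p) (<ᵇ-asym p r)

-- Positions carry weights; with indicator functions as weights, one count serves every choice of
-- letters.
above : ∀ {n} (h k : Fin n → ℕ) (p q : ℕ) → ℕ
above h k p q = sum λ r → h r * sum λ s → k s * 𝟙 (before p q (toℕ r) (toℕ s))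

quads : ∀ {n} (f g h k : Fin n → ℕ) → ℕ
quads f g h k = sum λ p → f p * sum λ q → g q * above h k (toℕ p) (toℕ q)

-- What is left of `quads` when one of its first two positions lies before everything else: only the
-- other one still constrains the last two.
triples : ∀ {n} (f h k : Fin n → ℕ) → ℕ
triples f h k = sum λ p → f p * above h k (toℕ p) (toℕ p)

above-suc : ∀ {n} (h k : Fin (suc n) → ℕ) p q → above h k p q ≡
  sum λ r → h (suc r) * sum λ s → k (suc s) * 𝟙 (before p q (suc (toℕ r)) (suc (toℕ s)))
above-suc h k p q = cong₂ _+_ first (sum-cong-≗ λ r → cong (h (suc r) *_) (cong (_+ rest r) (last r)))
  where
  rest = λ r → sum λ s → k (suc s) * 𝟙 (before p q (suc (toℕ r)) (suc (toℕ s)))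
  first : h zero * (sum λ s → k s * 0) ≡ 0
  first = trans (cong (h zero *_) (sum-zero _ λ s → *-zeroʳ (k s))) (*-zeroʳ (h zero))
  last : ∀ r → k zero * 𝟙 (before p q (suc (toℕ r)) 0) ≡ 0
  last r = trans (cong (λ b → k zero * 𝟙 b) (∧-zeroʳ (p <ᵇ suc (toℕ r)))) (*-zeroʳ (k zero))

above-0-0 : ∀ {n} (h k : Fin (suc n) → ℕ) → above h k 0 0 ≡ sum (h ∘ suc) * sum (k ∘ suc)
above-0-0 h k = trans (above-suc h k 0 0) (trans
  (sum-cong-≗ λ r → cong (h (suc r) *_) (sum-cong-≗ λ s → *-identityʳ (k (suc s))))
  (sym (*-distribʳ-sum (sum (k ∘ suc)) (h ∘ suc))))

above-cong : ∀ {n} (h k : Fin (suc n) → ℕ) p q p′ q′ →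
  (∀ r s → before p q (suc r) (suc s) ≡ before p′ q′ r s) →
  above h k p q ≡ above (h ∘ suc) (k ∘ suc) p′ q′
above-cong h k p q p′ q′ eq = trans (above-suc h k p q)
  (sum-cong-≗ λ r → cong (h (suc r) *_) (sum-cong-≗ λ s →
    cong (λ b → k (suc s) * 𝟙 b) (eq (toℕ r) (toℕ s))))

∧-double : ∀ a b → a ∧ b ≡ a ∧ b ∧ a ∧ b
∧-double false b     = refl
∧-double true  false = refl
∧-double true  true  = refl

∧-true : ∀ a b → a ∧ b ∧ true ≡ a ∧ b ∧ a ∧ b
∧-true false b     = refl
∧-true true  false = refl
∧-true true  true  = refl

triples-suc : ∀ {n} (f h k : Fin (suc n) → ℕ) → triples f h k ≡
  f zero * (sum (h ∘ suc) * sum (k ∘ suc)) + triples (f ∘ suc) (h ∘ suc) (k ∘ suc)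
triples-suc f h k = cong₂ _+_ (cong (f zero *_) (above-0-0 h k))
  (sum-cong-≗ λ p → cong (f (suc p) *_)
      (above-cong h k (suc (toℕ p)) (suc (toℕ p)) (toℕ p) (toℕ p) λ r s → refl))

-- The four cases are whether each of the first two positions is the front one. If just one is, its
-- constraints hold automatically and `triples` of the other remains. The last two positions can
-- never be at the front.
quads-suc : ∀ {n} (f g h k : Fin (suc n) → ℕ) → quads f g h k ≡
  f zero * (g zero * (sum (h ∘ suc) * sum (k ∘ suc)) + triples (g ∘ suc) (h ∘ suc) (k ∘ suc))
  + (g zero * triples (f ∘ suc) (h ∘ suc) (k ∘ suc)
     + quads (f ∘ suc) (g ∘ suc) (h ∘ suc) (k ∘ suc))
quads-suc f g h k = cong₂ _+_
  (cong (f zero *_) (cong₂ _+_ (cong (g zero *_) (above-0-0 h k))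
    (sum-cong-≗ λ q → cong (g (suc q) *_) (above-cong h k 0 (suc (toℕ q)) (toℕ q) (toℕ q)
      λ r s → ∧-double (toℕ q <ᵇ r) (toℕ q <ᵇ s)))))
  (begin
    (sum λ p → f (suc p) *
        (g zero * above h k (suc (toℕ p)) 0 + sum λ q → g (suc q) * above h k (suc (toℕ p)) (suc (toℕ q))))
      ≡⟨ (sum-cong-≗ λ p → trans
           (cong (f (suc p) *_) (cong₂ _+_
             (cong (g zero *_) (above-cong h k (suc (toℕ p)) 0 (toℕ p) (toℕ p) λ r s →
                 ∧-true (toℕ p <ᵇ r) (toℕ p <ᵇ s)))
             (sum-cong-≗ λ q → cong (g (suc q) *_)
                 (above-cong h k (suc (toℕ p)) (suc (toℕ q)) (toℕ p) (toℕ q) λ r s → refl))))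
           (distr (f (suc p)) (g zero) (above (h ∘ suc) (k ∘ suc) (toℕ p) (toℕ p))
             (sum λ q → g (suc q) * above (h ∘ suc) (k ∘ suc) (toℕ p) (toℕ q)))) ⟩
    (sum λ p → g zero * (f (suc p) * above (h ∘ suc) (k ∘ suc) (toℕ p) (toℕ p))
             + f (suc p) * sum λ q → g (suc q) * above (h ∘ suc) (k ∘ suc) (toℕ p) (toℕ q))
      ≡⟨ ∑-distrib-+ (λ p → g zero * (f (suc p) * above (h ∘ suc) (k ∘ suc) (toℕ p) (toℕ p))) _ ⟩
    (sum λ p → g zero * (f (suc p) * above (h ∘ suc) (k ∘ suc) (toℕ p) (toℕ p)))
    + quads (f ∘ suc) (g ∘ suc) (h ∘ suc) (k ∘ suc)
      ≡⟨ cong (_+ quads (f ∘ suc) (g ∘ suc) (h ∘ suc) (k ∘ suc)) (*-distribˡ-sum (g zero)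
           λ p → f (suc p) * above (h ∘ suc) (k ∘ suc) (toℕ p) (toℕ p)) ⟨
    g zero * triples (f ∘ suc) (h ∘ suc) (k ∘ suc)
    + quads (f ∘ suc) (g ∘ suc) (h ∘ suc) (k ∘ suc) ∎)
  where
  distr : ∀ x y u v → x * (y * u + v) ≡ y * (x * u) + x * v
  distr = solve-∀

-- scan φ ψ f g h k reads the positions from left to right; φ and ψ are the weights of f and g
-- already read, and each step accounts for the quadruples in which the later of the first two
-- positions is the current one.
scan : ∀ {n} (φ ψ : ℕ) (f g h k : Fin n → ℕ) → ℕ
scan {zero}  φ ψ f g h k = 0
scan {suc n} φ ψ f g h k =
  (f zero * g zero + φ * g zero + ψ * f zero) * (sum (h ∘ suc) * sum (k ∘ suc))
  + scan (f zero + φ) (g zero + ψ) (f ∘ suc) (g ∘ suc) (h ∘ suc) (k ∘ suc)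

-- A position already read precedes all that is left, so each unit of `φ` combines with a later
-- position of `g` into a `triples`, and each unit of `ψ` with one of `f`. This generalisation is
-- what the induction on the word needs.
quads-scan : ∀ {n} φ ψ (f g h k : Fin n → ℕ) →
  quads f g h k + φ * triples g h k + ψ * triples f h k ≡ scan φ ψ f g h k
quads-scan {zero}  φ ψ f g h k = cong₂ _+_ (*-zeroʳ φ) (*-zeroʳ ψ)
quads-scan {suc n} φ ψ f g h k = begin
  quads f g h k + φ * triples g h k + ψ * triples f h k
    ≡⟨ cong₂ _+_ (cong₂ _+_ (quads-suc f g h k) (cong (φ *_) (triples-suc g h k)))
        (cong (ψ *_) (triples-suc f h k)) ⟩
  _ ≡⟨ regroup (f zero) (g zero) φ ψ (sum (h ∘ suc) * sum (k ∘ suc))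
        (triples (g ∘ suc) (h ∘ suc) (k ∘ suc)) (triples (f ∘ suc) (h ∘ suc) (k ∘ suc))
        (quads (f ∘ suc) (g ∘ suc) (h ∘ suc) (k ∘ suc)) ⟩
  (f zero * g zero + φ * g zero + ψ * f zero) * (sum (h ∘ suc) * sum (k ∘ suc))
  + (quads (f ∘ suc) (g ∘ suc) (h ∘ suc) (k ∘ suc) + (f zero + φ) * triples (g ∘ suc) (h ∘ suc) (k ∘ suc)
      + (g zero + ψ) * triples (f ∘ suc) (h ∘ suc) (k ∘ suc))
    ≡⟨ cong (λ x → (f zero * g zero + φ * g zero + ψ * f zero) * (sum (h ∘ suc) * sum (k ∘ suc)) + x)
         (quads-scan (f zero + φ) (g zero + ψ) (f ∘ suc) (g ∘ suc) (h ∘ suc) (k ∘ suc)) ⟩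
  scan φ ψ f g h k ∎
  where
  regroup : ∀ f₀ g₀ φ ψ u tg tf x →
    f₀ * (g₀ * u + tg) + (g₀ * tf + x) + φ * (g₀ * u + tg) + ψ * (f₀ * u + tf)
    ≡ (f₀ * g₀ + φ * g₀ + ψ * f₀) * u + (x + (f₀ + φ) * tg + (g₀ + ψ) * tf)
  regroup = solve-∀

-- `f` is the multiplicity with which `e` hits each position. The test function `F` makes this a
-- change of variable that can be applied to one summation of `sum₄` at a time.
Realises : ∀ {d n} → (Fin d → ℕ) → (Fin n → ℕ) → Set
Realises e f = ∀ F → sum (F ∘ e) ≡ sum λ k → f k * F (toℕ k)

sum₄-before : ∀ {a b c d n}
  (e₁ : Fin a → ℕ) (e₂ : Fin b → ℕ) (e₃ : Fin c → ℕ) (e₄ : Fin d → ℕ) (f g h k : Fin n → ℕ) →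
  Realises e₁ f → Realises e₂ g → Realises e₃ h → Realises e₄ k →
  sum₄ (λ p q r s → 𝟙 (before (e₁ p) (e₂ q) (e₃ r) (e₄ s))) ≡ scan 0 0 f g h k
sum₄-before e₁ e₂ e₃ e₄ f g h k r₁ r₂ r₃ r₄ = begin
  sum₄ (λ p q r s → 𝟙 (before (e₁ p) (e₂ q) (e₃ r) (e₄ s)))
    ≡⟨ (r₁ λ P → sum λ q → sum λ r → sum λ s → 𝟙 (before P (e₂ q) (e₃ r) (e₄ s))) ⟩
  (sum λ p → f p * sum λ q → sum λ r → sum λ s → 𝟙 (before (toℕ p) (e₂ q) (e₃ r) (e₄ s)))
    ≡⟨ (sum-cong-≗ λ p → cong (f p *_) (trans
         (r₂ λ Q → sum λ r → sum λ s → 𝟙 (before (toℕ p) Q (e₃ r) (e₄ s)))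
         (sum-cong-≗ λ q → cong (g q *_) (trans
           (r₃ λ R → sum λ s → 𝟙 (before (toℕ p) (toℕ q) R (e₄ s)))
           (sum-cong-≗ λ r → cong (h r *_)
             (r₄ λ S → 𝟙 (before (toℕ p) (toℕ q) (toℕ r) S))))))) ⟩
  quads f g h k
    ≡⟨ trans (+-identityʳ _) (+-identityʳ _) ⟨
  quads f g h k + 0 * triples g h k + 0 * triples f h k
    ≡⟨ quads-scan 0 0 f g h k ⟩
  scan 0 0 f g h k ∎

sum₄-separated : ∀ {a b c d n}
  (e₁ : Fin a → ℕ) (e₂ : Fin b → ℕ) (e₃ : Fin c → ℕ) (e₄ : Fin d → ℕ) (f g h k : Fin n → ℕ) →
  Realises e₁ f → Realises e₂ g → Realises e₃ h → Realises e₄ k →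
  sum₄ (λ p q r s → 𝟙 (separated (e₁ p) (e₂ q) (e₃ r) (e₄ s)))
  ≡ scan 0 0 f g h k + scan 0 0 h k f g
sum₄-separated e₁ e₂ e₃ e₄ f g h k r₁ r₂ r₃ r₄ = begin
  sum₄ (λ p q r s → 𝟙 (separated (e₁ p) (e₂ q) (e₃ r) (e₄ s)))
    ≡⟨ (sum₄-cong λ p q r s → 𝟙-separated (e₁ p) (e₂ q) (e₃ r) (e₄ s)) ⟩
  sum₄ (λ p q r s → 𝟙 (before (e₁ p) (e₂ q) (e₃ r) (e₄ s)) + 𝟙 (before (e₃ r) (e₄ s) (e₁ p) (e₂ q)))
    ≡⟨ sum₄-+ (λ p q r s → 𝟙 (before (e₁ p) (e₂ q) (e₃ r) (e₄ s)))
        (λ p q r s → 𝟙 (before (e₃ r) (e₄ s) (e₁ p) (e₂ q))) ⟩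
  sum₄ (λ p q r s → 𝟙 (before (e₁ p) (e₂ q) (e₃ r) (e₄ s)))
  + sum₄ (λ p q r s → 𝟙 (before (e₃ r) (e₄ s) (e₁ p) (e₂ q)))
    ≡⟨ cong₂ _+_ (sum₄-before e₁ e₂ e₃ e₄ f g h k r₁ r₂ r₃ r₄)
        (trans (sum₄-swap λ p q r s → 𝟙 (before (e₃ r) (e₄ s) (e₁ p) (e₂ q)))
          (sum₄-before e₃ e₄ e₁ e₂ h k f g r₃ r₄ r₁ r₂)) ⟩
  scan 0 0 f g h k + scan 0 0 h k f g ∎

-- The number of separated pairs in a balanced word

data Part : Set where
  A B C : Part

-- `nothing` marks a position to be ignored, so that an ordering of all 3m + 1 vertices can be read
-- as a word for K_{m,m,m}.
isA isB isC : Maybe Part → ℕ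
isA (just A) = 1
isA _        = 0
isB (just B) = 1
isB _        = 0
isC (just C) = 1
isC _        = 0

-- α, β, γ letters A, B, C have been read before the word with indicator functions a, b, c.
crossings : ∀ {n} (α β γ : ℕ) (a b c : Fin n → ℕ) → ℕ
crossings α β γ a b c =
  (scan α β a b a c + scan α γ a c a b)
  + (scan α β a b b c + scan β γ b c a b)
  + (scan α γ a c b c + scan β γ b c a c)

-- The contribution of the current letter to the six scans. In each product the first factor counts
-- the edges completed by this letter, the second the edges lying entirely after it.
gain : (a₀ b₀ c₀ α β γ p q r : ℕ) → ℕ
gain a₀ b₀ c₀ α β γ p q r =
  ((a₀ * b₀ + α * b₀ + β * a₀) * (p * r) + (a₀ * c₀ + α * c₀ + γ * a₀) * (p * q))
  + ((a₀ * b₀ + α * b₀ + β * a₀) * (q * r) + (b₀ * c₀ + β * c₀ + γ * b₀) * (p * q))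
  + ((a₀ * c₀ + α * c₀ + γ * a₀) * (q * r) + (b₀ * c₀ + β * c₀ + γ * b₀) * (p * r))

crossings-suc : ∀ {n} α β γ (a b c : Fin (suc n) → ℕ) →
  crossings α β γ a b c ≡
  gain (a zero) (b zero) (c zero) α β γ (sum (a ∘ suc)) (sum (b ∘ suc)) (sum (c ∘ suc))
  + crossings (a zero + α) (b zero + β) (c zero + γ) (a ∘ suc) (b ∘ suc) (c ∘ suc)
crossings-suc α β γ a b c = regroup
  (ab * (p * r)) (ac * (p * q)) (ab * (q * r)) (bc * (p * q)) (ac * (q * r)) (bc * (p * r))
  (scan α′ β′ a′ b′ a′ c′) (scan α′ γ′ a′ c′ a′ b′) (scan α′ β′ a′ b′ b′ c′)
  (scan β′ γ′ b′ c′ a′ b′) (scan α′ γ′ a′ c′ b′ c′) (scan β′ γ′ b′ c′ a′ c′)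
  where
  a′ = a ∘ suc
  b′ = b ∘ suc
  c′ = c ∘ suc
  p = sum a′
  q = sum b′
  r = sum c′
  α′ = a zero + α
  β′ = b zero + β
  γ′ = c zero + γ
  ab = a zero * b zero + α * b zero + β * a zero
  ac = a zero * c zero + α * c zero + γ * a zero
  bc = b zero * c zero + β * c zero + γ * b zero
  regroup : ∀ i₁ i₂ i₃ i₄ i₅ i₆ s₁ s₂ s₃ s₄ s₅ s₆ →
    ((i₁ + s₁) + (i₂ + s₂)) + ((i₃ + s₃) + (i₄ + s₄)) + ((i₅ + s₅) + (i₆ + s₆))
    ≡ ((i₁ + i₂) + (i₃ + i₄) + (i₅ + i₆)) + ((s₁ + s₂) + (s₃ + s₄) + (s₅ + s₆))
  regroup = solve-∀

-- The letters `B` and `C` are the case `A` of `advance` with the parts renamed, by the symmetry of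
-- the potential. An ignored position gains nothing and leaves the potential unchanged.
advance-letter : ∀ ℓ m p q r α β γ x →
  α + (isA ℓ + p) ≡ m → β + (isB ℓ + q) ≡ m → γ + (isC ℓ + r) ≡ m →
  + 12 ℤ.* + x ℤ.≤ potential (+ m) (+ p) (+ q) (+ r) →
  + 12 ℤ.* + (gain (isA ℓ) (isB ℓ) (isC ℓ) α β γ p q r + x)
    ℤ.≤ potential (+ m) (+ (isA ℓ + p)) (+ (isB ℓ + q)) (+ (isC ℓ + r))
advance-letter (just A) m p q r α β γ x eα eβ eγ x≤ =
  advance m p q r β γ _ x (eq α β γ p q r) eβ eγ x≤
  where
  eq : ∀ α β γ p q r →
    ((0 + α * 0 + β * 1) * (p * r) + (0 + α * 0 + γ * 1) * (p * q))
    + ((0 + α * 0 + β * 1) * (q * r) + (0 + β * 0 + γ * 0) * (p * q))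
    + ((0 + α * 0 + γ * 1) * (q * r) + (0 + β * 0 + γ * 0) * (p * r))
    ≡ β * (r * (p + q)) + γ * (q * (p + r))
  eq = solve-∀
advance-letter (just B) m p q r α β γ x eα eβ eγ x≤ =
  subst (+ 12 ℤ.* + (gain 0 1 0 α β γ p q r + x) ℤ.≤_) (potential-swap (+ m) (+ suc q) (+ p) (+ r))
    (advance m q p r α γ _ x (eq α β γ p q r) eα eγ
      (subst (+ 12 ℤ.* + x ℤ.≤_) (potential-swap (+ m) (+ p) (+ q) (+ r)) x≤))
  where
  eq : ∀ α β γ p q r →
    ((0 + α * 1 + β * 0) * (p * r) + (0 + α * 0 + γ * 0) * (p * q))
    + ((0 + α * 1 + β * 0) * (q * r) + (0 + β * 0 + γ * 1) * (p * q))
    + ((0 + α * 0 + γ * 0) * (q * r) + (0 + β * 0 + γ * 1) * (p * r))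
    ≡ α * (r * (q + p)) + γ * (p * (q + r))
  eq = solve-∀
advance-letter (just C) m p q r α β γ x eα eβ eγ x≤ =
  subst (+ 12 ℤ.* + (gain 0 0 1 α β γ p q r + x) ℤ.≤_) (sym (potential-rotate (+ m) (+ p) (+ q) (+ suc r)))
    (advance m r p q α β _ x (eq α β γ p q r) eα eβ
      (subst (+ 12 ℤ.* + x ℤ.≤_) (potential-rotate (+ m) (+ p) (+ q) (+ r)) x≤))
  where
  eq : ∀ α β γ p q r →
    ((0 + α * 0 + β * 0) * (p * r) + (0 + α * 1 + γ * 0) * (p * q))
    + ((0 + α * 0 + β * 0) * (q * r) + (0 + β * 1 + γ * 0) * (p * q))
    + ((0 + α * 1 + γ * 0) * (q * r) + (0 + β * 1 + γ * 0) * (p * r))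
    ≡ α * (q * (r + p)) + β * (p * (r + q))
  eq = solve-∀
advance-letter nothing m p q r α β γ x eα eβ eγ x≤ =
  subst (λ y → + 12 ℤ.* + (y + x) ℤ.≤ potential (+ m) (+ p) (+ q) (+ r)) (sym (eq α β γ p q r)) x≤
  where
  eq : ∀ α β γ p q r →
    ((0 + α * 0 + β * 0) * (p * r) + (0 + α * 0 + γ * 0) * (p * q))
    + ((0 + α * 0 + β * 0) * (q * r) + (0 + β * 0 + γ * 0) * (p * q))
    + ((0 + α * 0 + γ * 0) * (q * r) + (0 + β * 0 + γ * 0) * (p * r))
    ≡ 0
  eq = solve-∀

-- Induction along the word: the hypotheses, that letters read and letters left add up to `m`, are
-- invariant under reading one letter, and at the end of the word both sides are 0.
crossings-bound : ∀ {n} m α β γ (w : Fin n → Maybe Part) →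
  α + sum (isA ∘ w) ≡ m → β + sum (isB ∘ w) ≡ m → γ + sum (isC ∘ w) ≡ m →
  + 12 ℤ.* + crossings α β γ (isA ∘ w) (isB ∘ w) (isC ∘ w)
    ℤ.≤ potential (+ m) (+ sum (isA ∘ w)) (+ sum (isB ∘ w)) (+ sum (isC ∘ w))
crossings-bound {zero} m α β γ w eα eβ eγ = ℤ.≤-reflexive (sym (zeroed (+ m)))
  where
  zeroed : ∀ i → + 0 ℤ.+ i ℤ.* + 0 ≡ + 0
  zeroed = ℤ-Ring.solve-∀
crossings-bound {suc n} m α β γ w eα eβ eγ =
  subst (λ x → + 12 ℤ.* + x ℤ.≤ potential (+ m) (+ sum (isA ∘ w)) (+ sum (isB ∘ w)) (+ sum (isC ∘ w)))
    (sym (crossings-suc α β γ (isA ∘ w) (isB ∘ w) (isC ∘ w)))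
    (advance-letter (w zero) m p q r α β γ x eα eβ eγ
      (crossings-bound m (isA (w zero) + α) (isB (w zero) + β) (isC (w zero) + γ) (w ∘ suc)
        (shift α (isA (w zero)) p eα) (shift β (isB (w zero)) q eβ) (shift γ (isC (w zero)) r eγ)))
  where
  p = sum (isA ∘ w ∘ suc)
  q = sum (isB ∘ w ∘ suc)
  r = sum (isC ∘ w ∘ suc)
  x = crossings (isA (w zero) + α) (isB (w zero) + β) (isC (w zero) + γ)
        (isA ∘ w ∘ suc) (isB ∘ w ∘ suc) (isC ∘ w ∘ suc)
  shift : ∀ δ u v → δ + (u + v) ≡ m → u + δ + v ≡ m
  shift δ u v eq = trans (trans (cong (_+ v) (+-comm u δ)) (+-assoc δ u v)) eq

balanced-crossings : ∀ {k} n (w : Fin k → Maybe Part) → let m = suc n in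
  sum (isA ∘ w) ≡ m → sum (isB ∘ w) ≡ m → sum (isC ∘ w) ≡ m →
  12 * crossings 0 0 0 (isA ∘ w) (isB ∘ w) (isC ∘ w) ≤ 6 * (m * m * n * suc (2 * m))
balanced-crossings n w eA eB eC = ℤ.drop‿+≤+ (subst₂ ℤ._≤_
  (sym (ℤ.pos-* 12 (crossings 0 0 0 (isA ∘ w) (isB ∘ w) (isC ∘ w))))
  (trans (cong₂ (λ y z → potential (+ m) (+ y) (+ z) (+ sum (isC ∘ w))) eA eB)
    (trans (cong (λ y → potential (+ m) (+ m) (+ m) (+ y)) eC) (potential-initial n)))
  (crossings-bound m 0 0 0 w eA eB eC))
  where
  m = suc n

-- The lower bound

sum-const : ∀ n x → sum {n} (λ _ → x) ≡ n * x
sum-const zero    x = refl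
sum-const (suc n) x = cong (_+_ x) (sum-const n x)

sum-↑ : ∀ a {b} (f : Fin (a + b) → ℕ) → sum f ≡ sum (λ i → f (i ↑ˡ b)) + sum (λ j → f (a ↑ʳ j))
sum-↑ zero    f = refl
sum-↑ (suc a) f = trans (cong (_+_ (f zero)) (sum-↑ a (f ∘ suc))) (sym (+-assoc (f zero) _ _))

sum-mono-≤ : ∀ {n} {f g : Fin n → ℕ} → (∀ i → f i ≤ g i) → sum f ≤ sum g
sum-mono-≤ {zero}  f≤g = z≤n
sum-mono-≤ {suc n} f≤g = +-mono-≤ (f≤g zero) (sum-mono-≤ (f≤g ∘ suc))

const≤sum : ∀ {n} x (f : Fin n → ℕ) → (∀ i → x ≤ f i) → n * x ≤ sum f
const≤sum {n} x f x≤f = subst (_≤ sum f) (sum-const n x) (sum-mono-≤ x≤f)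

const≤sum-except : ∀ {n} x (f : Fin (suc n) → ℕ) i → (∀ j → i ≢ j → x ≤ f j) → n * x ≤ sum f
const≤sum-except x f i x≤f = ≤-trans
  (const≤sum x (f ∘ punchIn i) λ j → x≤f (punchIn i j) (punchInᵢ≢i i j ∘ sym))
  (subst (sum (f ∘ punchIn i) ≤_) (sym (sum-remove {i = i} f)) (m≤n+m _ _))

sum₄-zero : ∀ {a b c d} (F : Fin a → Fin b → Fin c → Fin d → ℕ) →
  (∀ p q r s → F p q r s ≡ 0) → sum₄ F ≡ 0
sum₄-zero F F≡0 =
  sum-zero (λ p → sum λ q → sum λ r → sum (F p q r)) λ p →
  sum-zero (λ q → sum λ r → sum (F p q r)) λ q →
  sum-zero (λ r → sum (F p q r)) λ r → sum-zero (F p q r) (F≡0 p q r)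

-- The digits in `13`, `23` and `24` name the two variables that run over the same part. They must
-- differ for the edges to be nonincident, which leaves `n` of the `suc n` values for the second of
-- them.
const≤sum₄-13 : ∀ {n b d} t (F : Fin (suc n) → Fin b → Fin (suc n) → Fin d → ℕ) →
  (∀ p q r s → p ≢ r → t ≤ F p q r s) → suc n * (b * (n * (d * t))) ≤ sum₄ F
const≤sum₄-13 {n} {b} {d} t F t≤F =
  const≤sum (b * (n * (d * t))) (λ p → sum λ q → sum λ r → sum (F p q r)) λ p →
  const≤sum (n * (d * t)) (λ q → sum λ r → sum (F p q r)) λ q →
  const≤sum-except (d * t) (λ r → sum (F p q r)) p λ r p≢r →
  const≤sum t (F p q r) λ s → t≤F p q r s p≢r

const≤sum₄-23 : ∀ {a n d} t (F : Fin a → Fin (suc n) → Fin (suc n) → Fin d → ℕ) →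
  (∀ p q r s → q ≢ r → t ≤ F p q r s) → a * (suc n * (n * (d * t))) ≤ sum₄ F
const≤sum₄-23 {a} {n} {d} t F t≤F =
  const≤sum (suc n * (n * (d * t))) (λ p → sum λ q → sum λ r → sum (F p q r)) λ p →
  const≤sum (n * (d * t)) (λ q → sum λ r → sum (F p q r)) λ q →
  const≤sum-except (d * t) (λ r → sum (F p q r)) q λ r q≢r →
  const≤sum t (F p q r) λ s → t≤F p q r s q≢r

const≤sum₄-24 : ∀ {a n c} t (F : Fin a → Fin (suc n) → Fin c → Fin (suc n) → ℕ) →
  (∀ p q r s → q ≢ s → t ≤ F p q r s) → a * (suc n * (c * (n * t))) ≤ sum₄ F
const≤sum₄-24 {a} {n} {c} t F t≤F =
  const≤sum (suc n * (c * (n * t))) (λ p → sum λ q → sum λ r → sum (F p q r)) λ p →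
  const≤sum (c * (n * t)) (λ q → sum λ r → sum (F p q r)) λ q →
  const≤sum (n * t) (λ r → sum (F p q r)) λ r →
  const≤sum-except t (F p q r) q λ s q≢s → t≤F p q r s q≢s

-- The vertices of the three parts.

module Vertices (m : ℕ) where

  V : Set
  V = Fin (suc m + m + m)

  vA : Fin (suc m) → V
  vA i = (i ↑ˡ m) ↑ˡ m

  vB : Fin m → V
  vB i = (suc m ↑ʳ i) ↑ˡ m

  vC : Fin m → V
  vC i = (suc m + m) ↑ʳ i

  part-vA : ∀ i → part (suc m) m m (vA i) ≡ 0
  part-vA i rewrite splitAt-↑ˡ (suc m + m) (i ↑ˡ m) m | splitAt-↑ˡ (suc m) i m = refl

  part-vB : ∀ i → part (suc m) m m (vB i) ≡ 1
  part-vB i rewrite splitAt-↑ˡ (suc m + m) (suc m ↑ʳ i) m | splitAt-↑ʳ (suc m) m i = refl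

  part-vC : ∀ i → part (suc m) m m (vC i) ≡ 2
  part-vC i rewrite splitAt-↑ʳ (suc m + m) m i = refl

  AB : ∀ i j → IsEdge (suc m) m m (vA i) (vB j)
  AB i j eq = contradiction (trans (sym (part-vA i)) (trans eq (part-vB j))) λ ()

  AC : ∀ i j → IsEdge (suc m) m m (vA i) (vC j)
  AC i j eq = contradiction (trans (sym (part-vA i)) (trans eq (part-vC j))) λ ()

  BC : ∀ i j → IsEdge (suc m) m m (vB i) (vC j)
  BC i j eq = contradiction (trans (sym (part-vB i)) (trans eq (part-vC j))) λ ()

  vA-injective : ∀ {i j} → vA i ≡ vA j → i ≡ j
  vA-injective eq = ↑ˡ-injective m _ _ (↑ˡ-injective m _ _ eq)

  vB-injective : ∀ {i j} → vB i ≡ vB j → i ≡ j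
  vB-injective eq = ↑ʳ-injective (suc m) _ _ (↑ˡ-injective m _ _ eq)

  vC-injective : ∀ {i j} → vC i ≡ vC j → i ≡ j
  vC-injective eq = ↑ʳ-injective (suc m + m) _ _ eq

  sum-V : (f : V → ℕ) → sum f ≡ sum (f ∘ vA) + sum (f ∘ vB) + sum (f ∘ vC)
  sum-V f = trans (sum-↑ (suc m + m) f) (cong (_+ sum (f ∘ vC)) (sum-↑ (suc m) (λ i → f (i ↑ˡ m))))

module Lower (m′ : ℕ) where

  m : ℕ
  m = suc m′

  open Vertices m

  -- One vertex of the large part is left out: K_{m,m,m} already forces the bound.
  uA : Fin m → V
  uA = vA ∘ suc

  letterA : Fin (suc m) → Maybe Part
  letterA zero    = nothing
  letterA (suc _) = just A

  letter : V → Maybe Part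
  letter v = [ (λ i → [ letterA , const (just B) ]′ (splitAt (suc m) i)) , const (just C) ]′
      (splitAt (suc m + m) v)

  letter-vA : ∀ i → letter (vA i) ≡ letterA i
  letter-vA i rewrite splitAt-↑ˡ (suc m + m) (i ↑ˡ m) m | splitAt-↑ˡ (suc m) i m = refl

  letter-vB : ∀ i → letter (vB i) ≡ just B
  letter-vB i rewrite splitAt-↑ˡ (suc m + m) (suc m ↑ʳ i) m | splitAt-↑ʳ (suc m) m i = refl

  letter-vC : ∀ i → letter (vC i) ≡ just C
  letter-vC i rewrite splitAt-↑ʳ (suc m + m) m i = refl

  -- Keeping the indicator `is` abstract treats the three letters at once; for a concrete one, all
  -- but one of the four coefficients become 0.
  sum-letter : ∀ (is : Maybe Part → ℕ) (H : V → ℕ) → (sum λ v → is (letter v) * H v) ≡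
    (is nothing * H (vA zero) + is (just A) * sum (H ∘ uA)) + is (just B) * sum (H ∘ vB) + is (just C)
        * sum (H ∘ vC)
  sum-letter is H = trans (sum-V λ v → is (letter v) * H v) (cong₂ _+_ (cong₂ _+_
    (cong₂ _+_ (cong (λ ℓ → is ℓ * H (vA zero)) (letter-vA zero))
      (pull (just A) uA (letter-vA ∘ suc)))
    (pull (just B) vB letter-vB)) (pull (just C) vC letter-vC))
    where
    pull : ∀ ℓ (e : Fin m → V) → (∀ i → letter (e i) ≡ ℓ) →
      (sum λ i → is (letter (e i)) * H (e i)) ≡ is ℓ * sum (H ∘ e)
    pull ℓ e eq = trans (sum-cong-≗ λ i → cong (λ ℓ → is ℓ * H (e i)) (eq i))
      (sym (*-distribˡ-sum (is ℓ) (H ∘ e)))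

  sum-isA : ∀ H → (sum λ v → isA (letter v) * H v) ≡ sum (H ∘ uA)
  sum-isA H = trans (sum-letter isA H)
    (trans (+-identityʳ _) (trans (+-identityʳ _) (*-identityˡ _)))

  sum-isB : ∀ H → (sum λ v → isB (letter v) * H v) ≡ sum (H ∘ vB)
  sum-isB H = trans (sum-letter isB H) (trans (+-identityʳ _) (*-identityˡ _))

  sum-isC : ∀ H → (sum λ v → isC (letter v) * H v) ≡ sum (H ∘ vC)
  sum-isC H = trans (sum-letter isC H) (*-identityˡ _)

  module _ (σ : Permutation′ (suc m + m + m)) where

    -- `σ` sends vertices to positions, so the letter at position `k` is found through the inverse.
    word : V → Maybe Part
    word k = letter (σ ⟨$⟩ˡ k)

    realises : ∀ (is : Maybe Part → ℕ) (e : Fin m → V) →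
      (∀ H → (sum λ v → is (letter v) * H v) ≡ sum (H ∘ e)) → Realises (pos σ ∘ e) (is ∘ word)
    realises is e sum-is F = trans (sym (sum-is (F ∘ pos σ)))
      (trans (sum-permute (λ v → is (letter v) * F (pos σ v)) (flip σ))
        (sum-cong-≗ λ k → cong (λ j → is (word k) * F (toℕ j)) (inverseʳ σ {k})))

    sum-word : ∀ (is : Maybe Part → ℕ) (e : Fin m → V) →
      (∀ H → (sum λ v → is (letter v) * H v) ≡ sum (H ∘ e)) → sum (is ∘ word) ≡ m
    sum-word is e sum-is = trans (sym (sum-permute (is ∘ letter) (flip σ)))
      (trans (sum-cong-≗ λ v → sym (*-identityʳ (is (letter v))))
        (trans (sum-is λ _ → 1) (trans (sum-const m 1) (*-identityʳ m))))

    sep : (e₁ e₂ e₃ e₄ : Fin m → V) → ℕ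
    sep e₁ e₂ e₃ e₄ = sum₄ λ p q r s → 𝟙 (separates σ (e₁ p) (e₂ q) (e₃ r) (e₄ s))

    sep-crossings : sep uA vB uA vC + sep uA vB vB vC + sep uA vC vB vC
      ≡ crossings 0 0 0 (isA ∘ word) (isB ∘ word) (isC ∘ word)
    sep-crossings = cong₂ _+_ (cong₂ _+_
      (sum₄-separated (pos σ ∘ uA) (pos σ ∘ vB) (pos σ ∘ uA) (pos σ ∘ vC) a b a c rA rB rA rC)
      (sum₄-separated (pos σ ∘ uA) (pos σ ∘ vB) (pos σ ∘ vB) (pos σ ∘ vC) a b b c rA rB rB rC))
      (sum₄-separated (pos σ ∘ uA) (pos σ ∘ vC) (pos σ ∘ vB) (pos σ ∘ vC) a c b c rA rC rB rC)
      where
      a = isA ∘ word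
      b = isB ∘ word
      c = isC ∘ word
      rA = realises isA uA sum-isA
      rB = realises isB vB sum-isB
      rC = realises isC vC sum-isC

    sep-bound : 12 * (sep uA vB uA vC + sep uA vB vB vC + sep uA vC vB vC)
      ≤ 6 * (m * m * m′ * suc (2 * m))
    sep-bound = subst (λ x → 12 * x ≤ 6 * (m * m * m′ * suc (2 * m))) (sym sep-crossings)
      (balanced-crossings m′ word (sum-word isA uA sum-isA) (sum-word isB vB sum-isB)
          (sum-word isC vC sum-isC))

  cs : List (Permutation′ (suc m + m + m)) → (e₁ e₂ e₃ e₄ : Fin m → V) → ℕ
  cs L e₁ e₂ e₃ e₄ = sum₄ λ p q r s → countSep L (e₁ p) (e₂ q) (e₃ r) (e₄ s)

  cs-[] : ∀ e₁ e₂ e₃ e₄ → cs [] e₁ e₂ e₃ e₄ ≡ 0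
  cs-[] _ _ _ _ = sum₄-zero (λ (_ _ _ _ : Fin m) → 0) λ _ _ _ _ → refl

  cs-∷ : ∀ σ L e₁ e₂ e₃ e₄ → cs (σ ∷ L) e₁ e₂ e₃ e₄ ≡ sep σ e₁ e₂ e₃ e₄ + cs L e₁ e₂ e₃ e₄
  cs-∷ σ L e₁ e₂ e₃ e₄ = sum₄-+ (λ p q r s → 𝟙 (separates σ (e₁ p) (e₂ q) (e₃ r) (e₄ s)))
    (λ p q r s → countSep L (e₁ p) (e₂ q) (e₃ r) (e₄ s))

  cs-bound : ∀ L → 12 * (cs L uA vB uA vC + cs L uA vB vB vC + cs L uA vC vB vC)
    ≤ length L * (6 * (m * m * m′ * suc (2 * m)))
  cs-bound [] = ≤-reflexive (cong (12 *_) (cong₂ _+_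
    (cong₂ _+_ (cs-[] uA vB uA vC) (cs-[] uA vB vB vC)) (cs-[] uA vC vB vC)))
  cs-bound (σ ∷ L) = subst (_≤ length (σ ∷ L) * (6 * (m * m * m′ * suc (2 * m)))) (sym split)
    (+-mono-≤ (sep-bound σ) (cs-bound L))
    where
    regroup : ∀ x₁ x₂ x₃ y₁ y₂ y₃ →
      12 * ((x₁ + y₁) + (x₂ + y₂) + (x₃ + y₃)) ≡ 12 * (x₁ + x₂ + x₃) + 12 * (y₁ + y₂ + y₃)
    regroup = solve-∀
    split : 12 * (cs (σ ∷ L) uA vB uA vC + cs (σ ∷ L) uA vB vB vC + cs (σ ∷ L) uA vC vB vC)
      ≡ 12 * (sep σ uA vB uA vC + sep σ uA vB vB vC + sep σ uA vC vB vC)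
        + 12 * (cs L uA vB uA vC + cs L uA vB vB vC + cs L uA vC vB vC)
    split = trans
      (cong (12 *_) (cong₂ _+_ (cong₂ _+_ (cs-∷ σ L uA vB uA vC) (cs-∷ σ L uA vB vB vC))
          (cs-∷ σ L uA vC vB vC)))
      (regroup (sep σ uA vB uA vC) (sep σ uA vB vB vC) (sep σ uA vC vB vC)
        (cs L uA vB uA vC) (cs L uA vB vB vC) (cs L uA vC vB vC))

  module _ {t L} (tsep : TSeparating (suc m) m m t L) where

    cs-ABAC : m * (m * (m′ * (m * t))) ≤ cs L uA vB uA vC
    cs-ABAC = const≤sum₄-13 t (λ p q r s → countSep L (uA p) (vB q) (uA r) (vC s)) λ p q r s p≢r →
      tsep (uA p) (vB q) (uA r) (vC s) (AB (suc p) q) (AC (suc r) s)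
        ( p≢r ∘ Fin.suc-injective ∘ vA-injective , AC (suc p) s ∘ cong (part (suc m) m m)
        , AB (suc r) q ∘ sym ∘ cong (part (suc m) m m) , BC q s ∘ cong (part (suc m) m m))

    cs-ABBC : m * (m * (m′ * (m * t))) ≤ cs L uA vB vB vC
    cs-ABBC = const≤sum₄-23 t (λ p q r s → countSep L (uA p) (vB q) (vB r) (vC s)) λ p q r s q≢r →
      tsep (uA p) (vB q) (vB r) (vC s) (AB (suc p) q) (BC r s)
        ( AB (suc p) r ∘ cong (part (suc m) m m) , AC (suc p) s ∘ cong (part (suc m) m m)
        , q≢r ∘ vB-injective , BC q s ∘ cong (part (suc m) m m))

    cs-ACBC : m * (m * (m * (m′ * t))) ≤ cs L uA vC vB vC
    cs-ACBC = const≤sum₄-24 t (λ p q r s → countSep L (uA p) (vC q) (vB r) (vC s)) λ p q r s q≢s →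
      tsep (uA p) (vC q) (vB r) (vC s) (AC (suc p) q) (BC r s)
        ( AB (suc p) r ∘ cong (part (suc m) m m) , AC (suc p) s ∘ cong (part (suc m) m m)
        , BC r q ∘ sym ∘ cong (part (suc m) m m) , q≢s ∘ vC-injective)

    -- Double counting: each of the three types has `m * m * m′ * m` pairs, each separated at least
    -- `t` times, while every ordering in `L` contributes at most `sep-bound`. The factor common to
    -- both sides is kept for a later cancellation.
    separating-bound : 6 * m * (m * m * m′ * 6) * t ≤ length L * suc (2 * m) * (m * m * m′ * 6)
    separating-bound = ≤-trans (≤-reflexive (eq₁ m m′ t)) (≤-trans
      (*-monoʳ-≤ 12 (+-mono-≤ (+-mono-≤ cs-ABAC cs-ABBC) cs-ACBC))
      (≤-trans (cs-bound L) (≤-reflexive (eq₂ (length L) (m * m * m′) (suc (2 * m))))))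
      where
      eq₁ : ∀ m n t → 6 * m * (m * m * n * 6) * t
        ≡ 12 * (m * (m * (n * (m * t))) + m * (m * (n * (m * t))) + m * (m * (m * (n * t))))
      eq₁ = solve-∀
      eq₂ : ∀ l x y → l * (6 * (x * y)) ≡ l * y * (x * 6)
      eq₂ = solve-∀

-- The word (ABC)^m A

-- The indicator of a letter in the periodic word. Recursion with period three makes the same
-- functions reappear by computation once a block has been read.
χ : Part → ℕ → ℕ
χ X (suc (suc (suc k))) = χ X k
χ A 0 = 1
χ B 1 = 1
χ C 2 = 1
χ _ _ = 0

-- The term `χ X 0` is the final letter of the word, present only for `A`.
sum-χ : ∀ X m → sum {suc (m * 3)} (χ X ∘ toℕ) ≡ χ X 0 + m
sum-χ X zero    = refl
sum-χ X (suc m) = trans (cong (λ s → χ X 0 + (χ X 1 + (χ X 2 + s))) (sum-χ X m)) (period X m)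
  where
  period : ∀ X m → χ X 0 + (χ X 1 + (χ X 2 + (χ X 0 + m))) ≡ χ X 0 + suc m
  period A m = refl
  period B m = refl
  period C m = refl

χ-period : ∀ X p → χ X 2 + (χ X 1 + (χ X 0 + p)) ≡ suc p
χ-period A p = refl
χ-period B p = refl
χ-period C p = refl

-- The part of scanWord contributed by one block ABC that is preceded by p blocks and followed by
-- (ABC)^m A.
blockGain : (X Y Z W : Part) → ℕ → ℕ → ℕ
blockGain X Y Z W m p =
  (χ X 0 * χ Y 0 + p * χ Y 0 + p * χ X 0)
    * ((χ Z 1 + (χ Z 2 + (χ Z 0 + m))) * (χ W 1 + (χ W 2 + (χ W 0 + m))))
  + ((χ X 1 * χ Y 1 + (χ X 0 + p) * χ Y 1 + (χ Y 0 + p) * χ X 1)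
      * ((χ Z 2 + (χ Z 0 + m)) * (χ W 2 + (χ W 0 + m)))
    + (χ X 2 * χ Y 2 + (χ X 1 + (χ X 0 + p)) * χ Y 2 + (χ Y 1 + (χ Y 0 + p)) * χ X 2)
      * ((χ Z 0 + m) * (χ W 0 + m)))

χᴱ : Part → ℕ → Expr ℕ 2
χᴱ X i = Κ (χ X i)

blockGainᴱ : (X Y Z W : Part) → Expr ℕ 2 → Expr ℕ 2 → Expr ℕ 2
blockGainᴱ X Y Z W m p =
  (χᴱ X 0 ⊗ χᴱ Y 0 ⊕ p ⊗ χᴱ Y 0 ⊕ p ⊗ χᴱ X 0)
    ⊗ ((χᴱ Z 1 ⊕ (χᴱ Z 2 ⊕ (χᴱ Z 0 ⊕ m))) ⊗ (χᴱ W 1 ⊕ (χᴱ W 2 ⊕ (χᴱ W 0 ⊕ m))))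
  ⊕ ((χᴱ X 1 ⊗ χᴱ Y 1 ⊕ (χᴱ X 0 ⊕ p) ⊗ χᴱ Y 1 ⊕ (χᴱ Y 0 ⊕ p) ⊗ χᴱ X 1)
      ⊗ ((χᴱ Z 2 ⊕ (χᴱ Z 0 ⊕ m)) ⊗ (χᴱ W 2 ⊕ (χᴱ W 0 ⊕ m)))
    ⊕ (χᴱ X 2 ⊗ χᴱ Y 2 ⊕ (χᴱ X 1 ⊕ (χᴱ X 0 ⊕ p)) ⊗ χᴱ Y 2 ⊕ (χᴱ Y 1 ⊕ (χᴱ Y 0 ⊕ p)) ⊗ χᴱ X 2)
      ⊗ ((χᴱ Z 0 ⊕ m) ⊗ (χᴱ W 0 ⊕ m)))

-- `p` blocks count as already read, each with one of every letter. Reading a block turns (`suc m`,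
-- `p`) into (`m`, `suc p`), so the recurrence needs both arguments.
scanWord : (X Y Z W : Part) → ℕ → ℕ → ℕ
scanWord X Y Z W m p = scan {suc (m * 3)} p p (χ X ∘ toℕ) (χ Y ∘ toℕ) (χ Z ∘ toℕ) (χ W ∘ toℕ)

scanWord-suc : ∀ X Y Z W m p →
  scanWord X Y Z W (suc m) p ≡ blockGain X Y Z W m p + scanWord X Y Z W m (suc p)
scanWord-suc X Y Z W m p = begin
  scanWord X Y Z W (suc m) p
    ≡⟨ cong₂ shape (sum-χ Z m) (sum-χ W m) ⟩
  shape (χ Z 0 + m) (χ W 0 + m)
    ≡⟨ reassoc (g₀ * _) (g₁ * _) (g₂ * _) rest ⟩
  blockGain X Y Z W m p + rest
    ≡⟨ cong (_+_ (blockGain X Y Z W m p))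
        (cong₂ (λ x y → scan {suc (m * 3)} x y (χ X ∘ toℕ) (χ Y ∘ toℕ) (χ Z ∘ toℕ) (χ W ∘ toℕ))
         (χ-period X p) (χ-period Y p)) ⟩
  blockGain X Y Z W m p + scanWord X Y Z W m (suc p) ∎
  where
  g₀ = χ X 0 * χ Y 0 + p * χ Y 0 + p * χ X 0
  g₁ = χ X 1 * χ Y 1 + (χ X 0 + p) * χ Y 1 + (χ Y 0 + p) * χ X 1
  g₂ = χ X 2 * χ Y 2 + (χ X 1 + (χ X 0 + p)) * χ Y 2 + (χ Y 1 + (χ Y 0 + p)) * χ X 2
  rest = scan {suc (m * 3)} (χ X 2 + (χ X 1 + (χ X 0 + p))) (χ Y 2 + (χ Y 1 + (χ Y 0 + p)))
    (χ X ∘ toℕ) (χ Y ∘ toℕ) (χ Z ∘ toℕ) (χ W ∘ toℕ)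
  shape : ℕ → ℕ → ℕ
  shape H K =
    g₀ * ((χ Z 1 + (χ Z 2 + H)) * (χ W 1 + (χ W 2 + K)))
    + (g₁ * ((χ Z 2 + H) * (χ W 2 + K)) + (g₂ * (H * K) + rest))
  reassoc : ∀ x y z w → x + (y + (z + w)) ≡ x + (y + z) + w
  reassoc = solve-∀

-- The closed forms have negative coefficients, which are collected in minus.
record ClosedForm (X Y Z W : Part) : Set where
  field
    minus plus : ℕ → ℕ → ℕ
    base       : ∀ p → minus 0 p ≡ plus 0 p
    step       : ∀ m p → plus m (suc p) + (6 * blockGain X Y Z W m p + minus (suc m) p)
                         ≡ plus (suc m) p + minus m (suc p)

  closed : ∀ m p → 6 * scanWord X Y Z W m p + minus m p ≡ plus m p
  -- Only the final `A` is left, and no edge can follow it: the scan is 0.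
  closed zero p =
    trans (cong (λ x → 6 * (x + 0) + minus 0 p) (*-zeroʳ (χ X 0 * χ Y 0 + p * χ Y 0 + p * χ X 0))) (base p)
  -- The negative part of the induction hypothesis is added to both sides, in place of a
  -- subtraction.
  closed (suc m) p = +-cancelʳ-≡ (minus m (suc p)) _ _ (begin
    6 * scanWord X Y Z W (suc m) p + minus (suc m) p + minus m (suc p)
      ≡⟨ cong (λ x → 6 * x + minus (suc m) p + minus m (suc p)) (scanWord-suc X Y Z W m p) ⟩
    6 * (blockGain X Y Z W m p + scanWord X Y Z W m (suc p)) + minus (suc m) p + minus m (suc p)
      ≡⟨ regroup (blockGain X Y Z W m p) (scanWord X Y Z W m (suc p)) (minus (suc m) p) (minus m (suc p)) ⟩
    6 * scanWord X Y Z W m (suc p) + minus m (suc p) + (6 * blockGain X Y Z W m p + minus (suc m) p)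
      ≡⟨ cong (_+ (6 * blockGain X Y Z W m p + minus (suc m) p)) (closed m (suc p)) ⟩
    plus m (suc p) + (6 * blockGain X Y Z W m p + minus (suc m) p)
      ≡⟨ step m p ⟩
    plus (suc m) p + minus m (suc p) ∎)
    where
    regroup : ∀ i x a b → 6 * (i + x) + a + b ≡ 6 * x + b + (6 * i + a)
    regroup = solve-∀

open ClosedForm

stepᴱ : (X Y Z W : Part) (minus plus : Expr ℕ 2 → Expr ℕ 2 → Expr ℕ 2) →
  Expr ℕ 2 → Expr ℕ 2 → Expr ℕ 2 × Expr ℕ 2
stepᴱ X Y Z W minus plus m p =
  plus m (Κ 1 ⊕ p) ⊕ (Κ 6 ⊗ blockGainᴱ X Y Z W m p ⊕ minus (Κ 1 ⊕ m) p) ,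
  plus (Κ 1 ⊕ m) p ⊕ minus m (Κ 1 ⊕ p)

-- Each closed form is of degree 4 in `m` and linear in `p`; its values are forced by the recurrence
-- in `step` and the value 0 at `m = 0`. The factor 6 clears the denominators.
ABAC : ClosedForm A B A C
ABAC = record
  { minus = λ m p → 0
  ; plus  = λ m p → m * (1 + 2 * p + m * (2 + 6 * p) + m * m * (2 + 4 * p) + m * m * m)
  ; base  = λ p → refl
  ; step  = ℕ-Expr.solve 2 (stepᴱ A B A C
      (λ m p → Κ 0)
      (λ m p → m ⊗ (Κ 1 ⊕ Κ 2 ⊗ p ⊕ m ⊗ (Κ 2 ⊕ Κ 6 ⊗ p) ⊕ m ⊗ m ⊗ (Κ 2 ⊕ Κ 4 ⊗ p) ⊕ m ⊗ m ⊗ m))) refl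
  }

-- `ABAB`, `ACAC` and `BCAC` share this closed form for a reason: if the letters of the first edge
-- lie in blocks i, j and those of the second in blocks k, l, all four patterns ask for i < k, i ≤
-- l, j < k and j < l.
ACAB : ClosedForm A C A B
ACAB = record
  { minus = λ m p → m * (1 + p + m)
  ; plus  = λ m p → m * (m * (3 * p) + m * m * (1 + 4 * p) + m * m * m)
  ; base  = λ p → refl
  ; step  = ℕ-Expr.solve 2 (stepᴱ A C A B
      (λ m p → m ⊗ (Κ 1 ⊕ p ⊕ m))
      (λ m p → m ⊗ (m ⊗ (Κ 3 ⊗ p) ⊕ m ⊗ m ⊗ (Κ 1 ⊕ Κ 4 ⊗ p) ⊕ m ⊗ m ⊗ m))) refl
  }

ABBC : ClosedForm A B B C
ABBC = record
  { minus = λ m p → m * (1 + p + m)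
  ; plus  = λ m p → m * (m * (3 * p) + m * m * (1 + 4 * p) + m * m * m)
  ; base  = λ p → refl
  ; step  = ℕ-Expr.solve 2 (stepᴱ A B B C
      (λ m p → m ⊗ (Κ 1 ⊕ p ⊕ m))
      (λ m p → m ⊗ (m ⊗ (Κ 3 ⊗ p) ⊕ m ⊗ m ⊗ (Κ 1 ⊕ Κ 4 ⊗ p) ⊕ m ⊗ m ⊗ m))) refl
  }

BCAB : ClosedForm B C A B
BCAB = record
  { minus = λ m p → m * (4 * p + m)
  ; plus  = λ m p → m * (m * m * (4 * p) + m * m * m)
  ; base  = λ p → refl
  ; step  = ℕ-Expr.solve 2 (stepᴱ B C A B
      (λ m p → m ⊗ (Κ 4 ⊗ p ⊕ m))
      (λ m p → m ⊗ (m ⊗ m ⊗ (Κ 4 ⊗ p) ⊕ m ⊗ m ⊗ m))) refl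
  }

ACBC : ClosedForm A C B C
ACBC = record
  { minus = λ m p → m * m
  ; plus  = λ m p → m * (2 * p + m * m * (4 * p) + m * m * m)
  ; base  = λ p → refl
  ; step  = ℕ-Expr.solve 2 (stepᴱ A C B C
      (λ m p → m ⊗ m)
      (λ m p → m ⊗ (Κ 2 ⊗ p ⊕ m ⊗ m ⊗ (Κ 4 ⊗ p) ⊕ m ⊗ m ⊗ m))) refl
  }

BCAC : ClosedForm B C A C
BCAC = record
  { minus = λ m p → m * (1 + p + m)
  ; plus  = λ m p → m * (m * (3 * p) + m * m * (1 + 4 * p) + m * m * m)
  ; base  = λ p → refl
  ; step  = ℕ-Expr.solve 2 (stepᴱ B C A C
      (λ m p → m ⊗ (Κ 1 ⊕ p ⊕ m))
      (λ m p → m ⊗ (m ⊗ (Κ 3 ⊗ p) ⊕ m ⊗ m ⊗ (Κ 1 ⊕ Κ 4 ⊗ p) ⊕ m ⊗ m ⊗ m))) refl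
  }

ABAB : ClosedForm A B A B
ABAB = record
  { minus = λ m p → m * (1 + p + m)
  ; plus  = λ m p → m * (m * (3 * p) + m * m * (1 + 4 * p) + m * m * m)
  ; base  = λ p → refl
  ; step  = ℕ-Expr.solve 2 (stepᴱ A B A B
      (λ m p → m ⊗ (Κ 1 ⊕ p ⊕ m))
      (λ m p → m ⊗ (m ⊗ (Κ 3 ⊗ p) ⊕ m ⊗ m ⊗ (Κ 1 ⊕ Κ 4 ⊗ p) ⊕ m ⊗ m ⊗ m))) refl
  }

ACAC : ClosedForm A C A C
ACAC = record
  { minus = λ m p → m * (1 + p + m)
  ; plus  = λ m p → m * (m * (3 * p) + m * m * (1 + 4 * p) + m * m * m)
  ; base  = λ p → refl
  ; step  = ℕ-Expr.solve 2 (stepᴱ A C A C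
      (λ m p → m ⊗ (Κ 1 ⊕ p ⊕ m))
      (λ m p → m ⊗ (m ⊗ (Κ 3 ⊗ p) ⊕ m ⊗ m ⊗ (Κ 1 ⊕ Κ 4 ⊗ p) ⊕ m ⊗ m ⊗ m))) refl
  }

BCBC : ClosedForm B C B C
BCBC = record
  { minus = λ m p → m * (p + m + m * (3 * p) + m * m)
  ; plus  = λ m p → m * (1 + m * m * (4 * p) + m * m * m)
  ; base  = λ p → refl
  ; step  = ℕ-Expr.solve 2 (stepᴱ B C B C
      (λ m p → m ⊗ (p ⊕ m ⊕ m ⊗ (Κ 3 ⊗ p) ⊕ m ⊗ m))
      (λ m p → m ⊗ (Κ 1 ⊕ m ⊗ m ⊗ (Κ 4 ⊗ p) ⊕ m ⊗ m ⊗ m))) refl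
  }

add-closed : ∀ {X Y Z W} (c : ClosedForm X Y Z W) (d : ClosedForm Z W X Y) m t →
  plus c m 0 + plus d m 0 ≡ t + (minus c m 0 + minus d m 0) →
  6 * (scanWord X Y Z W m 0 + scanWord Z W X Y m 0) ≡ t
add-closed {X} {Y} {Z} {W} c d m t eq =
  +-cancelʳ-≡ (minus c m 0 + minus d m 0) (6 * (scanWord X Y Z W m 0 + scanWord Z W X Y m 0)) t
    (trans (regroup (scanWord X Y Z W m 0) (scanWord Z W X Y m 0) (minus c m 0) (minus d m 0))
      (trans (cong₂ _+_ (closed c m 0) (closed d m 0)) eq))
  where
  regroup : ∀ x y n₁ n₂ → 6 * (x + y) + (n₁ + n₂) ≡ (6 * x + n₁) + (6 * y + n₂)
  regroup = solve-∀

-- Divided by 6 and by the (m + 1)m³ choices of distinct vertices, this is the frequency (2m +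
-- 1)/(6m). The totals for AB-BC and AC-BC, over (m + 1)m²(m - 1) choices each, give the same
-- frequency.
ABAC-total : ∀ m → 6 * (scanWord A B A C m 0 + scanWord A C A B m 0)
  ≡ m * m * (1 + m) * (1 + 2 * m)
ABAC-total m = add-closed ABAC ACAB m (m * m * (1 + m) * (1 + 2 * m)) (eq m)
  where
  eq : ∀ m → m * (1 + 2 * 0 + m * (2 + 6 * 0) + m * m * (2 + 4 * 0) + m * m * m) + m
      * (m * (3 * 0) + m * m * (1 + 4 * 0) + m * m * m)
    ≡ m * m * (1 + m) * (1 + 2 * m) + (0 + m * (1 + 0 + m))
  eq = solve-∀

-- `n` is m - 1, the number of choices for the second, different vertex of the part B.
ABBC-total : ∀ m n → m ≡ suc n →
  6 * (scanWord A B B C m 0 + scanWord B C A B m 0) ≡ m * n * (1 + m) * (1 + 2 * m)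
ABBC-total m n refl = add-closed ABBC BCAB m (m * n * (1 + m) * (1 + 2 * m)) (eq n)
  where
  eq : ∀ n → (1 + n) * ((1 + n) * (3 * 0) + (1 + n) * (1 + n) * (1 + 4 * 0) + (1 + n) * (1 + n) * (1 + n))
      + (1 + n) * ((1 + n) * (1 + n) * (4 * 0) + (1 + n) * (1 + n) * (1 + n))
    ≡ (1 + n) * n * (1 + (1 + n)) * (1 + 2 * (1 + n))
        + ((1 + n) * (1 + 0 + (1 + n)) + (1 + n) * (4 * 0 + (1 + n)))
  eq = solve-∀

ACBC-total : ∀ m n → m ≡ suc n →
  6 * (scanWord A C B C m 0 + scanWord B C A C m 0) ≡ m * n * (1 + m) * (1 + 2 * m)
ACBC-total m n refl = add-closed ACBC BCAC m (m * n * (1 + m) * (1 + 2 * m)) (eq n)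
  where
  eq : ∀ n → (1 + n) * (2 * 0 + (1 + n) * (1 + n) * (4 * 0) + (1 + n) * (1 + n) * (1 + n)) + (1 + n)
      * ((1 + n) * (3 * 0) + (1 + n) * (1 + n) * (1 + 4 * 0) + (1 + n) * (1 + n) * (1 + n))
    ≡ (1 + n) * n * (1 + (1 + n)) * (1 + 2 * (1 + n)) + ((1 + n) * (1 + n) + (1 + n) * (1 + 0 + (1 + n)))
  eq = solve-∀

-- Over the (m + 1)m²(m - 1) choices this is the frequency (2m + 2)/(6m), above the required one;
-- the same holds for AC-AC and BC-BC.
ABAB-total : ∀ m n → m ≡ suc n →
  6 * (scanWord A B A B m 0 + scanWord A B A B m 0) ≡ 2 * m * n * (1 + m) * (1 + m)
ABAB-total m n refl = add-closed ABAB ABAB m (2 * m * n * (1 + m) * (1 + m)) (eq n)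
  where
  eq : ∀ n → (1 + n) * ((1 + n) * (3 * 0) + (1 + n) * (1 + n) * (1 + 4 * 0) + (1 + n) * (1 + n) * (1 + n))
      + (1 + n) * ((1 + n) * (3 * 0) + (1 + n) * (1 + n) * (1 + 4 * 0) + (1 + n) * (1 + n) * (1 + n))
    ≡ 2 * (1 + n) * n * (1 + (1 + n)) * (1 + (1 + n))
        + ((1 + n) * (1 + 0 + (1 + n)) + (1 + n) * (1 + 0 + (1 + n)))
  eq = solve-∀

ACAC-total : ∀ m n → m ≡ suc n →
  6 * (scanWord A C A C m 0 + scanWord A C A C m 0) ≡ 2 * m * n * (1 + m) * (1 + m)
ACAC-total m n refl = add-closed ACAC ACAC m (2 * m * n * (1 + m) * (1 + m)) (eq n)
  where
  eq : ∀ n → (1 + n) * ((1 + n) * (3 * 0) + (1 + n) * (1 + n) * (1 + 4 * 0) + (1 + n) * (1 + n) * (1 + n))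
      + (1 + n) * ((1 + n) * (3 * 0) + (1 + n) * (1 + n) * (1 + 4 * 0) + (1 + n) * (1 + n) * (1 + n))
    ≡ 2 * (1 + n) * n * (1 + (1 + n)) * (1 + (1 + n))
        + ((1 + n) * (1 + 0 + (1 + n)) + (1 + n) * (1 + 0 + (1 + n)))
  eq = solve-∀

BCBC-total : ∀ m n → m ≡ suc n →
  6 * (scanWord B C B C m 0 + scanWord B C B C m 0) ≡ 2 * m * n * n * (1 + m)
BCBC-total m n refl = add-closed BCBC BCBC m (2 * m * n * n * (1 + m)) (eq n)
  where
  eq : ∀ n → (1 + n) * (1 + (1 + n) * (1 + n) * (4 * 0) + (1 + n) * (1 + n) * (1 + n)) + (1 + n)
      * (1 + (1 + n) * (1 + n) * (4 * 0) + (1 + n) * (1 + n) * (1 + n))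
    ≡ 2 * (1 + n) * n * n * (1 + (1 + n))
        + ((1 + n) * (0 + (1 + n) + (1 + n) * (3 * 0) + (1 + n) * (1 + n)) + (1 + n)
        * (0 + (1 + n) + (1 + n) * (3 * 0) + (1 + n) * (1 + n)))
  eq = solve-∀

-- Averaging over all permutations

total : ∀ {X : Set} → List X → (X → ℕ) → ℕ
total []       f = 0
total (x ∷ xs) f = f x + total xs f

total-cong : ∀ {X : Set} (xs : List X) {f g : X → ℕ} → (∀ x → f x ≡ g x) → total xs f ≡ total xs g
total-cong []       eq = refl
total-cong (x ∷ xs) eq = cong₂ _+_ (eq x) (total-cong xs eq)

total-++ : ∀ {X : Set} (xs ys : List X) f → total (xs ++ ys) f ≡ total xs f + total ys f
total-++ []       ys f = refl
total-++ (x ∷ xs) ys f = trans (cong (_+_ (f x)) (total-++ xs ys f)) (sym (+-assoc (f x) _ _))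

total-map : ∀ {X Y : Set} (h : X → Y) (xs : List X) f → total (map h xs) f ≡ total xs (f ∘ h)
total-map h []       f = refl
total-map h (x ∷ xs) f = cong (_+_ (f (h x))) (total-map h xs f)

total-concatMap : ∀ {X Y : Set} (h : X → List Y) (xs : List X) f →
  total (concatMap h xs) f ≡ total xs (λ x → total (h x) f)
total-concatMap h []       f = refl
total-concatMap h (x ∷ xs) f =
  trans (total-++ (h x) (concatMap h xs) f) (cong (_+_ (total (h x) f)) (total-concatMap h xs f))

total-tabulate : ∀ {X : Set} {n} (h : Fin n → X) f → total (tabulate h) f ≡ sum (f ∘ h)
total-tabulate {n = zero}  h f = refl
total-tabulate {n = suc n} h f = cong (_+_ (f (h zero))) (total-tabulate (h ∘ suc) f)

total-* : ∀ {X : Set} (xs : List X) c (f : X → ℕ) → total xs (λ x → c * f x) ≡ c * total xs f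
total-* []       c f = sym (*-zeroʳ c)
total-* (x ∷ xs) c f = trans (cong (λ y → c * f x + y) (total-* xs c f)) (sym (*-distribˡ-+ c (f x) _))

length-total : ∀ {X : Set} (xs : List X) → length xs ≡ total xs (λ _ → 1)
length-total []       = refl
length-total (x ∷ xs) = cong suc (length-total xs)

-- All n! permutations, sorted by the image `p` of `zero`; the other images come from a smaller
-- permutation through `punchIn p`.
perms : ∀ n → List (Permutation′ n)
perms zero    = idₚ ∷ []
perms (suc n) = concatMap (λ p → map (insert zero p) (perms n)) (allFin (suc n))

total-perms-suc : ∀ n (F : Permutation′ (suc n) → ℕ) →
  total (perms (suc n)) F ≡ sum λ p → total (perms n) (F ∘ insert zero p)
total-perms-suc n F = begin
  total (perms (suc n)) F
    ≡⟨ total-concatMap (λ p → map (insert zero p) (perms n)) (allFin (suc n)) F ⟩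
  total (allFin (suc n)) (λ p → total (map (insert zero p) (perms n)) F)
    ≡⟨ total-tabulate id (λ p → total (map (insert zero p) (perms n)) F) ⟩
  (sum λ p → total (map (insert zero p) (perms n)) F)
    ≡⟨ (sum-cong-≗ λ p → total-map (insert zero p) (perms n) F) ⟩
  (sum λ p → total (perms n) (F ∘ insert zero p)) ∎

total-perms-const : ∀ n c → total (perms n) (λ _ → c) ≡ n ! * c
total-perms-const zero    c = refl
total-perms-const (suc n) c = begin
  total (perms (suc n)) (λ _ → c)
    ≡⟨ total-perms-suc n (λ _ → c) ⟩
  (sum {suc n} λ p → total (perms n) (λ _ → c))
    ≡⟨ sum-const (suc n) _ ⟩
  suc n * total (perms n) (λ _ → c)
    ≡⟨ cong (suc n *_) (total-perms-const n c) ⟩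
  suc n * (n ! * c)
    ≡⟨ *-assoc (suc n) (n !) c ⟨
  suc n ! * c ∎

sum-punchIn : ∀ {n} (f : Fin (suc n) → ℕ) i → sum f ≡ f i + sum (f ∘ punchIn i)
sum-punchIn f i = sum-remove {i = i} f

-- Each value is left out for exactly one of the `suc n` choices of `p`. The omitted values, `sum f`
-- in all, are added to both sides.
sum-sum-punchIn : ∀ {n} (f : Fin (suc n) → ℕ) → (sum λ p → sum (f ∘ punchIn p)) ≡ n * sum f
sum-sum-punchIn {n} f = +-cancelˡ-≡ (sum f) _ _ (begin
  sum f + (sum λ p → sum (f ∘ punchIn p))
    ≡⟨ ∑-distrib-+ f (λ p → sum (f ∘ punchIn p)) ⟨
  (sum λ p → f p + sum (f ∘ punchIn p))
    ≡⟨ (sum-cong-≗ λ p → sym (sum-punchIn f p)) ⟩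
  (sum {suc n} λ p → sum f)
    ≡⟨ sum-const (suc n) (sum f) ⟩
  suc n * sum f ∎)

-- Every value is the image of `i` under exactly n! of the (n + 1)! permutations.
total-perms₁ : ∀ n (f : Fin (suc n) → ℕ) i → total (perms (suc n)) (λ σ → f (σ ⟨$⟩ʳ i)) ≡ n ! * sum f
total-perms₁ n f zero = begin
  total (perms (suc n)) (λ σ → f (σ ⟨$⟩ʳ zero))
    ≡⟨ total-perms-suc n (λ σ → f (σ ⟨$⟩ʳ zero)) ⟩
  (sum λ p → total (perms n) (λ _ → f p))
    ≡⟨ (sum-cong-≗ λ p → total-perms-const n (f p)) ⟩
  (sum λ p → n ! * f p)
    ≡⟨ *-distribˡ-sum (n !) f ⟨
  n ! * sum f ∎
total-perms₁ (suc n) f (suc i) = begin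
  total (perms (suc (suc n))) (λ σ → f (σ ⟨$⟩ʳ suc i))
    ≡⟨ total-perms-suc (suc n) (λ σ → f (σ ⟨$⟩ʳ suc i)) ⟩
  (sum λ p → total (perms (suc n)) (λ σ → f (insert zero p σ ⟨$⟩ʳ suc i)))
    ≡⟨ (sum-cong-≗ λ p → total-cong (perms (suc n)) λ σ → cong f (insert-punchIn zero p σ i)) ⟩
  (sum λ p → total (perms (suc n)) (λ σ → f (punchIn p (σ ⟨$⟩ʳ i))))
    ≡⟨ (sum-cong-≗ λ p → total-perms₁ n (f ∘ punchIn p) i) ⟩
  (sum λ p → n ! * sum (f ∘ punchIn p))
    ≡⟨ *-distribˡ-sum (n !) (λ p → sum (f ∘ punchIn p)) ⟨
  n ! * (sum λ p → sum (f ∘ punchIn p))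
    ≡⟨ cong (n ! *_) (sum-sum-punchIn f) ⟩
  n ! * (suc n * sum f)
    ≡⟨ assoc (n !) (suc n) (sum f) ⟩
  suc n ! * sum f ∎
  where
  assoc : ∀ x y z → x * (y * z) ≡ y * x * z
  assoc = solve-∀

module _ {n} (F : Fin (suc n) → Fin (suc n) → ℕ) (F-diag : ∀ p → F p p ≡ 0) where

  sum-offdiag : ∀ p → sum (F p ∘ punchIn p) ≡ sum (F p)
  sum-offdiag p = sym (trans (sum-punchIn (F p) p) (cong (_+ sum (F p ∘ punchIn p)) (F-diag p)))

  sum-minor : ∀ p → sum (λ q → sum (F q)) ≡
    sum (F p) + (sum (λ q → F q p) + sum λ q → sum λ r → F (punchIn p q) (punchIn p r))
  sum-minor p = begin
    sum (λ q → sum (F q))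
      ≡⟨ sum-punchIn (λ q → sum (F q)) p ⟩
    sum (F p) + sum (λ q → sum (F (punchIn p q)))
      ≡⟨ cong (_+_ (sum (F p))) (trans (sum-cong-≗ λ q → sum-punchIn (F (punchIn p q)) p)
           (∑-distrib-+ (λ q → F (punchIn p q) p) (λ q → sum λ r → F (punchIn p q) (punchIn p r)))) ⟩
    sum (F p) + (sum (λ q → F (punchIn p q) p) + sum λ q → sum λ r → F (punchIn p q) (punchIn p r))
      ≡⟨ cong (λ x → sum (F p) + (x + sum λ q → sum λ r → F (punchIn p q) (punchIn p r)))
           (sym (trans (sum-punchIn (λ q → F q p) p) (cong (_+ sum (λ q → F (punchIn p q) p)) (F-diag p)))) ⟩
    sum (F p) + (sum (λ q → F q p) + sum λ q → sum λ r → F (punchIn p q) (punchIn p r)) ∎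

-- An off-diagonal entry survives the deletion of row and column `p` unless `p` is one of its two
-- indices, hence for n of the n + 2 choices. The two added copies of `S` restore the deleted rows
-- and columns.
sum-minors : ∀ {n} (F : Fin (suc (suc n)) → Fin (suc (suc n)) → ℕ) → (∀ p → F p p ≡ 0) →
  (sum λ p → sum λ q → sum λ r → F (punchIn p q) (punchIn p r)) ≡ n * sum λ p → sum (F p)
sum-minors {n} F F-diag = +-cancelˡ-≡ S _ _ (+-cancelˡ-≡ S _ _ (begin
  S + (S + sum minor)
    ≡⟨ cong (λ x → S + (x + sum minor)) (∑-comm F) ⟩
  S + (sum (λ p → sum λ q → F q p) + sum minor)
    ≡⟨ cong (_+_ S) (∑-distrib-+ (λ p → sum λ q → F q p) minor) ⟨
  S + sum (λ p → sum (λ q → F q p) + minor p)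
    ≡⟨ ∑-distrib-+ (λ p → sum (F p)) (λ p → sum (λ q → F q p) + minor p) ⟨
  sum (λ p → sum (F p) + (sum (λ q → F q p) + minor p))
    ≡⟨ (sum-cong-≗ λ p → sym (sum-minor F F-diag p)) ⟩
  sum {suc (suc n)} (λ p → S)
    ≡⟨ sum-const (suc (suc n)) S ⟩
  suc (suc n) * S ∎))
  where
  S = sum λ p → sum (F p)
  minor : Fin (suc (suc n)) → ℕ
  minor p = sum λ q → sum λ r → F (punchIn p q) (punchIn p r)

total-perms₂-zero : ∀ n (F : Fin (suc (suc n)) → Fin (suc (suc n)) → ℕ) → (∀ p → F p p ≡ 0) → ∀ j →
  total (perms (suc (suc n))) (λ σ → F (σ ⟨$⟩ʳ zero) (σ ⟨$⟩ʳ suc j)) ≡ n ! * sum λ p → sum (F p)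
total-perms₂-zero n F F-diag j = begin
  total (perms (suc (suc n))) (λ σ → F (σ ⟨$⟩ʳ zero) (σ ⟨$⟩ʳ suc j))
    ≡⟨ total-perms-suc (suc n) (λ σ → F (σ ⟨$⟩ʳ zero) (σ ⟨$⟩ʳ suc j)) ⟩
  (sum λ p → total (perms (suc n)) (λ σ → F p (insert zero p σ ⟨$⟩ʳ suc j)))
    ≡⟨ (sum-cong-≗ λ p → total-cong (perms (suc n)) λ σ → cong (F p) (insert-punchIn zero p σ j)) ⟩
  (sum λ p → total (perms (suc n)) (λ σ → F p (punchIn p (σ ⟨$⟩ʳ j))))
    ≡⟨ (sum-cong-≗ λ p → trans (total-perms₁ n (F p ∘ punchIn p) j)
        (cong (n ! *_) (sum-offdiag F F-diag p))) ⟩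
  (sum λ p → n ! * sum (F p))
    ≡⟨ *-distribˡ-sum (n !) (λ p → sum (F p)) ⟨
  n ! * (sum λ p → sum (F p)) ∎

-- Every ordered pair of distinct values is the image of (`i`, `j`) under exactly n! permutations.
-- As `F` vanishes on the diagonal, the sum may run over all pairs.
total-perms₂ : ∀ n (F : Fin (suc (suc n)) → Fin (suc (suc n)) → ℕ) → (∀ p → F p p ≡ 0) → ∀ i j → i ≢ j →
  total (perms (suc (suc n))) (λ σ → F (σ ⟨$⟩ʳ i) (σ ⟨$⟩ʳ j)) ≡ n ! * sum λ p → sum (F p)
total-perms₂ n F F-diag zero    zero    i≢j = contradiction refl i≢j
total-perms₂ n F F-diag zero    (suc j) i≢j = total-perms₂-zero n F F-diag j
total-perms₂ n F F-diag (suc i) zero    i≢j =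
  trans (total-perms₂-zero n (λ p q → F q p) F-diag i) (cong (n ! *_) (∑-comm λ p q → F q p))
total-perms₂ zero    F F-diag (suc zero) (suc zero) i≢j = contradiction refl i≢j
total-perms₂ (suc n) F F-diag (suc i) (suc j) i≢j = begin
  total (perms (suc (suc (suc n)))) (λ σ → F (σ ⟨$⟩ʳ suc i) (σ ⟨$⟩ʳ suc j))
    ≡⟨ total-perms-suc (suc (suc n)) (λ σ → F (σ ⟨$⟩ʳ suc i) (σ ⟨$⟩ʳ suc j)) ⟩
  (sum λ p → total (perms (suc (suc n))) (λ σ → F (insert zero p σ ⟨$⟩ʳ suc i) (insert zero p σ ⟨$⟩ʳ suc j)))
    ≡⟨ (sum-cong-≗ λ p → total-cong (perms (suc (suc n))) λ σ →
         cong₂ F (insert-punchIn zero p σ i) (insert-punchIn zero p σ j)) ⟩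
  (sum λ p → total (perms (suc (suc n))) (λ σ → F (punchIn p (σ ⟨$⟩ʳ i)) (punchIn p (σ ⟨$⟩ʳ j))))
    ≡⟨ (sum-cong-≗ λ p → total-perms₂ n (λ q r → F (punchIn p q) (punchIn p r))
        (λ q → F-diag (punchIn p q)) i j (i≢j ∘ cong suc)) ⟩
  (sum λ p → n ! * sum λ q → sum λ r → F (punchIn p q) (punchIn p r))
    ≡⟨ *-distribˡ-sum (n !) (λ p → sum λ q → sum λ r → F (punchIn p q) (punchIn p r)) ⟨
  n ! * (sum λ p → sum λ q → sum λ r → F (punchIn p q) (punchIn p r))
    ≡⟨ cong (n ! *_) (sum-minors F F-diag) ⟩
  n ! * (suc n * sum λ p → sum (F p))
    ≡⟨ assoc (n !) (suc n) (sum λ p → sum (F p)) ⟩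
  suc n ! * (sum λ p → sum (F p)) ∎
  where
  assoc : ∀ x y z → x * (y * z) ≡ y * x * z
  assoc = solve-∀

-- The orderings labelling (ABC)^m A

Slots : ℕ → Set
Slots m = (Fin (suc m) ⊎ Fin m) ⊎ Fin m

shift : ∀ {m} → Slots m → Slots (suc m)
shift = Sum.map (Sum.map suc suc) suc

interleave : ∀ m → Slots m → Fin (suc (m * 3))
-- The additional last letter A, after all complete blocks.
interleave zero    (inj₁ (inj₁ zero))    = zero
interleave (suc m) (inj₁ (inj₁ zero))    = zero
interleave (suc m) (inj₁ (inj₂ zero))    = suc zero
interleave (suc m) (inj₂ zero)           = suc (suc zero)
interleave (suc m) (inj₁ (inj₁ (suc i))) = suc (suc (suc (interleave m (inj₁ (inj₁ i)))))
interleave (suc m) (inj₁ (inj₂ (suc i))) = suc (suc (suc (interleave m (inj₁ (inj₂ i)))))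
interleave (suc m) (inj₂ (suc i))        = suc (suc (suc (interleave m (inj₂ i))))

deal : ∀ m → Fin (suc (m * 3)) → Slots m
deal zero    zero                = inj₁ (inj₁ zero)
deal (suc m) zero                = inj₁ (inj₁ zero)
deal (suc m) (suc zero)          = inj₁ (inj₂ zero)
deal (suc m) (suc (suc zero))    = inj₂ zero
deal (suc m) (suc (suc (suc k))) = shift (deal m k)

interleave-shift : ∀ m s → interleave (suc m) (shift s) ≡ suc (suc (suc (interleave m s)))
interleave-shift m (inj₁ (inj₁ i)) = refl
interleave-shift m (inj₁ (inj₂ i)) = refl
interleave-shift m (inj₂ i)        = refl

interleave-deal : ∀ m k → interleave m (deal m k) ≡ k
interleave-deal zero    zero                = refl
interleave-deal (suc m) zero                = refl
interleave-deal (suc m) (suc zero)          = refl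
interleave-deal (suc m) (suc (suc zero))    = refl
interleave-deal (suc m) (suc (suc (suc k))) =
  trans (interleave-shift m (deal m k)) (cong (λ k → suc (suc (suc k))) (interleave-deal m k))

deal-interleave : ∀ m s → deal m (interleave m s) ≡ s
deal-interleave zero    (inj₁ (inj₁ zero))    = refl
deal-interleave (suc m) (inj₁ (inj₁ zero))    = refl
deal-interleave (suc m) (inj₁ (inj₂ zero))    = refl
deal-interleave (suc m) (inj₂ zero)           = refl
deal-interleave (suc m) (inj₁ (inj₁ (suc i))) = cong shift (deal-interleave m (inj₁ (inj₁ i)))
deal-interleave (suc m) (inj₁ (inj₂ (suc i))) = cong shift (deal-interleave m (inj₁ (inj₂ i)))
deal-interleave (suc m) (inj₂ (suc i))        = cong shift (deal-interleave m (inj₂ i))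

slotA slotB slotC : ∀ {n} → Fin n → ℕ
slotA i = toℕ i * 3
slotB i = suc (toℕ i * 3)
slotC i = suc (suc (toℕ i * 3))

toℕ-interleaveA : ∀ m i → toℕ (interleave m (inj₁ (inj₁ i))) ≡ slotA i
toℕ-interleaveA zero    zero    = refl
toℕ-interleaveA (suc m) zero    = refl
toℕ-interleaveA (suc m) (suc i) = cong (_+_ 3) (toℕ-interleaveA m i)

toℕ-interleaveB : ∀ m i → toℕ (interleave m (inj₁ (inj₂ i))) ≡ slotB i
toℕ-interleaveB (suc m) zero    = refl
toℕ-interleaveB (suc m) (suc i) = cong (_+_ 3) (toℕ-interleaveB m i)

toℕ-interleaveC : ∀ m i → toℕ (interleave m (inj₂ i)) ≡ slotC i
toℕ-interleaveC (suc m) zero    = refl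
toℕ-interleaveC (suc m) (suc i) = cong (_+_ 3) (toℕ-interleaveC m i)

realises-slotA : ∀ m → Realises (slotA {suc m}) (λ (k : Fin (suc (m * 3))) → χ A (toℕ k))
realises-slotA zero    F = cong (_+ 0) (sym (+-identityʳ (F 0)))
realises-slotA (suc m) F = cong₂ _+_ (sym (+-identityʳ (F 0))) (realises-slotA m (F ∘ (_+_ 3)))

realises-slotB : ∀ m → Realises (slotB {m}) (λ (k : Fin (suc (m * 3))) → χ B (toℕ k))
realises-slotB zero    F = refl
realises-slotB (suc m) F = cong₂ _+_ (sym (+-identityʳ (F 1))) (realises-slotB m (F ∘ (_+_ 3)))

realises-slotC : ∀ m → Realises (slotC {m}) (λ (k : Fin (suc (m * 3))) → χ C (toℕ k))
realises-slotC zero    F = refl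
realises-slotC (suc m) F = cong₂ _+_ (sym (+-identityʳ (F 2))) (realises-slotC m (F ∘ (_+_ 3)))

size : ∀ m → suc (m * 3) ≡ suc m + m + m
size = solve-∀

module Order (m : ℕ) where

  open Vertices m

  splitV : V ↔ Slots m
  splitV = ↔-trans +↔⊎ (+↔⊎ ⊎-↔ ↔-refl)

  slots : Slots m ↔ Fin (suc (m * 3))
  slots = mk↔ₛ′ (interleave m) (deal m) (interleave-deal m) (deal-interleave m)

  -- The three permutations relabel inside the parts before the interleaving, so every such ordering
  -- spells the same word (ABC)^m A.
  order : Permutation′ (suc m) → Permutation′ m → Permutation′ m → Permutation′ (suc m + m + m)
  order α β γ = ↔-trans splitV (↔-trans ((α ⊎-↔ β) ⊎-↔ γ) (↔-trans slots (cast-id (size m))))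

  module _ (α : Permutation′ (suc m)) (β γ : Permutation′ m) where

    pos-order : ∀ v s → Inverse.to splitV v ≡ s →
      pos (order α β γ) v ≡ toℕ (interleave m (Sum.map (Sum.map (α ⟨$⟩ʳ_) (β ⟨$⟩ʳ_)) (γ ⟨$⟩ʳ_) s))
    pos-order v s refl = toℕ-cast (size m) _

    pos-vA : ∀ i → pos (order α β γ) (vA i) ≡ slotA (α ⟨$⟩ʳ i)
    pos-vA i = trans (pos-order (vA i) (inj₁ (inj₁ i)) split) (toℕ-interleaveA m (α ⟨$⟩ʳ i))
      where
      split : Inverse.to splitV (vA i) ≡ inj₁ (inj₁ i)
      split rewrite splitAt-↑ˡ (suc m + m) (i ↑ˡ m) m | splitAt-↑ˡ (suc m) i m = refl

    pos-vB : ∀ i → pos (order α β γ) (vB i) ≡ slotB (β ⟨$⟩ʳ i)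
    pos-vB i = trans (pos-order (vB i) (inj₁ (inj₂ i)) split) (toℕ-interleaveB m (β ⟨$⟩ʳ i))
      where
      split : Inverse.to splitV (vB i) ≡ inj₁ (inj₂ i)
      split rewrite splitAt-↑ˡ (suc m + m) (suc m ↑ʳ i) m | splitAt-↑ʳ (suc m) m i = refl

    pos-vC : ∀ i → pos (order α β γ) (vC i) ≡ slotC (γ ⟨$⟩ʳ i)
    pos-vC i = trans (pos-order (vC i) (inj₂ i) split) (toℕ-interleaveC m (γ ⟨$⟩ʳ i))
      where
      split : Inverse.to splitV (vC i) ≡ inj₂ i
      split rewrite splitAt-↑ʳ (suc m + m) m i = refl

-- The upper bound

<ᵇ-irrefl : ∀ p → (p <ᵇ p) ≡ false
<ᵇ-irrefl zero    = refl
<ᵇ-irrefl (suc p) = <ᵇ-irrefl p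

-- Edges with a common vertex are never separated: this and the two lemmas below supply the
-- vanishing diagonal required by `total-perms₂`.
separated-13 : ∀ p q s → 𝟙 (separated p q p s) ≡ 0
separated-13 p q s rewrite <ᵇ-irrefl p = refl

separated-23 : ∀ p q s → 𝟙 (separated q p p s) ≡ 0
separated-23 p q s rewrite <ᵇ-irrefl p | ∧-zeroʳ (q <ᵇ s) | ∧-zeroʳ (q <ᵇ p) | ∧-zeroʳ (p <ᵇ q) = refl

separated-24 : ∀ p q s → 𝟙 (separated q p s p) ≡ 0
separated-24 p q s rewrite <ᵇ-irrefl p | ∧-zeroʳ (p <ᵇ s) | ∧-zeroʳ (q <ᵇ p) | ∧-zeroʳ (q <ᵇ s)
  | ∧-zeroʳ (p <ᵇ q) | ∧-zeroʳ (s <ᵇ p) | ∧-zeroʳ (s <ᵇ q) = refl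

before-swapˡ : ∀ p q r s → before p q r s ≡ before q p r s
before-swapˡ p q r s = lemma (p <ᵇ r) (p <ᵇ s) (q <ᵇ r) (q <ᵇ s)
  where
  lemma : ∀ a b c d → a ∧ b ∧ c ∧ d ≡ c ∧ d ∧ a ∧ b
  lemma true  true  true  true  = refl
  lemma true  true  true  false = refl
  lemma true  true  false d     = refl
  lemma true  false c     d     = sym (trans (cong (c ∧_) (∧-zeroʳ d)) (∧-zeroʳ c))
  lemma false b     c     d     = sym (trans (cong (c ∧_) (∧-zeroʳ d)) (∧-zeroʳ c))

before-swapʳ : ∀ p q r s → before p q r s ≡ before p q s r
before-swapʳ p q r s = lemma (p <ᵇ r) (p <ᵇ s) (q <ᵇ r) (q <ᵇ s)
  where
  lemma : ∀ a b c d → a ∧ b ∧ c ∧ d ≡ b ∧ a ∧ d ∧ c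
  lemma true  true  true  true  = refl
  lemma true  true  true  false = refl
  lemma true  true  false true  = refl
  lemma true  true  false false = refl
  lemma true  false c     d     = refl
  lemma false true  c     d     = refl
  lemma false false c     d     = refl

separated-swapˡ : ∀ p q r s → separated p q r s ≡ separated q p r s
separated-swapˡ p q r s = cong₂ _∨_ (before-swapˡ p q r s) (before-swapʳ r s p q)

separated-swap : ∀ p q r s → separated p q r s ≡ separated r s p q
separated-swap p q r s = ∨-comm (before p q r s) (before r s p q)

countSep-total : ∀ {n} (L : List (Permutation′ n)) u v x y →
  countSep L u v x y ≡ total L (λ σ → 𝟙 (separates σ u v x y))
countSep-total []      u v x y = refl
countSep-total (σ ∷ L) u v x y = cong (_+_ (𝟙 (separates σ u v x y))) (countSep-total L u v x y)

countSep-cong : ∀ {n} (L : List (Permutation′ n)) {u v x y u′ v′ x′ y′} →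
  (∀ σ → separates σ u v x y ≡ separates σ u′ v′ x′ y′) → countSep L u v x y ≡ countSep L u′ v′ x′ y′
countSep-cong []      eq = refl
countSep-cong (σ ∷ L) eq = cong₂ _+_ (cong 𝟙 (eq σ)) (countSep-cong L eq)

countSep-swapˡ : ∀ {n} (L : List (Permutation′ n)) u v x y → countSep L u v x y ≡ countSep L v u x y
countSep-swapˡ L u v x y = countSep-cong L λ σ → separated-swapˡ (pos σ u) (pos σ v) (pos σ x) (pos σ y)

countSep-swap : ∀ {n} (L : List (Permutation′ n)) u v x y → countSep L u v x y ≡ countSep L x y u v
countSep-swap L u v x y = countSep-cong L λ σ → separated-swap (pos σ u) (pos σ v) (pos σ x) (pos σ y)

countSep-++ : ∀ {n} (L M : List (Permutation′ n)) u v x y →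
  countSep (L ++ M) u v x y ≡ countSep L u v x y + countSep M u v x y
countSep-++ []      M u v x y = refl
countSep-++ (σ ∷ L) M u v x y =
  trans (cong (_+_ (𝟙 (separates σ u v x y))) (countSep-++ L M u v x y))
      (sym (+-assoc (𝟙 (separates σ u v x y)) _ _))

countSep-replicate : ∀ {n} K (L : List (Permutation′ n)) u v x y →
  countSep (concat (replicate K L)) u v x y ≡ K * countSep L u v x y
countSep-replicate zero    L u v x y = refl
countSep-replicate (suc K) L u v x y =
  trans (countSep-++ L (concat (replicate K L)) u v x y)
      (cong (_+_ (countSep L u v x y)) (countSep-replicate K L u v x y))

length-replicate-concat : ∀ {X : Set} K (L : List X) → length (concat (replicate K L)) ≡ K * length L
length-replicate-concat zero    L = refl
length-replicate-concat (suc K) L = trans (length-++ L) (cong (_+_ (length L)) (length-replicate-concat K L))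

-- The permutations of the three parts are independent, so each one is averaged with the outer ones
-- fixed, the innermost first.
total³ : ∀ {X Y Z : Set} (xs : List X) (ys : List Y) (zs : List Z)
  (F : X → Y → Z → ℕ) (I : X → Y → ℕ) (J : X → ℕ) (S a b c : ℕ) →
  (∀ x y → total zs (F x y) ≡ c * I x y) → (∀ x → total ys (I x) ≡ b * J x) → total xs J ≡ a * S →
  total xs (λ x → total ys λ y → total zs (F x y)) ≡ c * (b * (a * S))
total³ xs ys zs F I J S a b c hz hy hx = begin
  total xs (λ x → total ys λ y → total zs (F x y))
    ≡⟨ (total-cong xs λ x → trans (trans (total-cong ys (hz x)) (total-* ys c (I x))) (cong (c *_) (hy x))) ⟩
  total xs (λ x → c * (b * J x))
    ≡⟨ trans (total-* xs c (λ x → b * J x)) (cong (c *_) (total-* xs b J)) ⟩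
  c * (b * total xs J)
    ≡⟨ cong (λ s → c * (b * s)) hx ⟩
  c * (b * (a * S)) ∎

-- Averaging treats two vertices of one part together and so sums them consecutively; this restores
-- the order edge by edge.
sum₄-comm : ∀ {a b c d} (F : Fin a → Fin b → Fin c → Fin d → ℕ) →
  (sum λ p → sum λ r → sum λ q → sum λ s → F p q r s) ≡ sum₄ F
sum₄-comm F = sum-cong-≗ λ p → ∑-comm λ r q → sum λ s → F p q r s

-- f, f₁, fₘ, fₛ stand for n!, (n + 1)!, m!, (m + 1)!, which as variables do not unfold to sums.
bound-ABAC : ∀ n f m f₁ fₘ fₛ → m ≡ suc (suc n) → f₁ ≡ suc n * f → fₘ ≡ m * f₁ → fₛ ≡ suc m * fₘ →
  suc (2 * m) * (fₘ * (fₘ * (fₛ * 1))) ≤ m * (f₁ * (f₁ * (f₁ * (m * m * (1 + m) * (1 + 2 * m)))))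
bound-ABAC n f m f₁ fₘ fₛ refl refl refl refl = ≤-reflexive (eq n f)
  where
  eq : ∀ n f → (1 + 2 * (2 + n))
      * (((2 + n) * ((1 + n) * f))
      * (((2 + n) * ((1 + n) * f)) * (((1 + (2 + n)) * ((2 + n) * ((1 + n) * f))) * 1)))
    ≡ (2 + n) * (((1 + n) * f)
        * (((1 + n) * f) * (((1 + n) * f) * ((2 + n) * (2 + n) * (1 + (2 + n)) * (1 + 2 * (2 + n))))))
  eq = solve-∀

bound-ABBC : ∀ n f m f₁ fₘ fₛ → m ≡ suc (suc n) → f₁ ≡ suc n * f → fₘ ≡ m * f₁ → fₛ ≡ suc m * fₘ →
  suc (2 * m) * (fₘ * (fₘ * (fₛ * 1))) ≤ m * (f₁ * (f * (fₘ * (m * suc n * (1 + m) * (1 + 2 * m)))))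
bound-ABBC n f m f₁ fₘ fₛ refl refl refl refl = ≤-reflexive (eq n f)
  where
  eq : ∀ n f → (1 + 2 * (2 + n))
      * (((2 + n) * ((1 + n) * f))
      * (((2 + n) * ((1 + n) * f)) * (((1 + (2 + n)) * ((2 + n) * ((1 + n) * f))) * 1)))
    ≡ (2 + n) * (((1 + n) * f)
        * (f * (((2 + n) * ((1 + n) * f)) * ((2 + n) * (1 + n) * (1 + (2 + n)) * (1 + 2 * (2 + n))))))
  eq = solve-∀

bound-ACBC : ∀ n f m f₁ fₘ fₛ → m ≡ suc (suc n) → f₁ ≡ suc n * f → fₘ ≡ m * f₁ → fₛ ≡ suc m * fₘ →
  suc (2 * m) * (fₘ * (fₘ * (fₛ * 1))) ≤ m * (f * (f₁ * (fₘ * (m * suc n * (1 + m) * (1 + 2 * m)))))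
bound-ACBC n f m f₁ fₘ fₛ refl refl refl refl = ≤-reflexive (eq n f)
  where
  eq : ∀ n f → (1 + 2 * (2 + n))
      * (((2 + n) * ((1 + n) * f))
      * (((2 + n) * ((1 + n) * f)) * (((1 + (2 + n)) * ((2 + n) * ((1 + n) * f))) * 1)))
    ≡ (2 + n) * (f * (((1 + n) * f)
        * (((2 + n) * ((1 + n) * f)) * ((2 + n) * (1 + n) * (1 + (2 + n)) * (1 + 2 * (2 + n))))))
  eq = solve-∀

bound-ABAB : ∀ n f m f₁ fₘ fₛ → m ≡ suc (suc n) → f₁ ≡ suc n * f → fₘ ≡ m * f₁ → fₛ ≡ suc m * fₘ →
  suc (2 * m) * (fₘ * (fₘ * (fₛ * 1))) ≤ m * (fₘ * (f * (f₁ * (2 * m * suc n * (1 + m) * (1 + m)))))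
-- The slack is 2(m + 1) against 2m + 1: the number of orderings, once.
bound-ABAB n f m f₁ fₘ fₛ refl refl refl refl = ≤-trans (m≤m+n _ _) (≤-reflexive (eq n f))
  where
  eq : ∀ n f → (1 + 2 * (2 + n))
      * (((2 + n) * ((1 + n) * f))
      * (((2 + n) * ((1 + n) * f)) * (((1 + (2 + n)) * ((2 + n) * ((1 + n) * f))) * 1)))
      + ((2 + n) * ((1 + n) * f))
      * (((2 + n) * ((1 + n) * f)) * (((1 + (2 + n)) * ((2 + n) * ((1 + n) * f))) * 1))
    ≡ (2 + n) * (((2 + n) * ((1 + n) * f))
        * (f * (((1 + n) * f) * (2 * (2 + n) * (1 + n) * (1 + (2 + n)) * (1 + (2 + n))))))
  eq = solve-∀

bound-ACAC : ∀ n f m f₁ fₘ fₛ → m ≡ suc (suc n) → f₁ ≡ suc n * f → fₘ ≡ m * f₁ → fₛ ≡ suc m * fₘ →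
  suc (2 * m) * (fₘ * (fₘ * (fₛ * 1))) ≤ m * (f * (fₘ * (f₁ * (2 * m * suc n * (1 + m) * (1 + m)))))
bound-ACAC n f m f₁ fₘ fₛ refl refl refl refl = ≤-trans (m≤m+n _ _) (≤-reflexive (eq n f))
  where
  eq : ∀ n f → (1 + 2 * (2 + n))
      * (((2 + n) * ((1 + n) * f))
      * (((2 + n) * ((1 + n) * f)) * (((1 + (2 + n)) * ((2 + n) * ((1 + n) * f))) * 1)))
      + ((2 + n) * ((1 + n) * f))
      * (((2 + n) * ((1 + n) * f)) * (((1 + (2 + n)) * ((2 + n) * ((1 + n) * f))) * 1))
    ≡ (2 + n) * (f * (((2 + n) * ((1 + n) * f))
        * (((1 + n) * f) * (2 * (2 + n) * (1 + n) * (1 + (2 + n)) * (1 + (2 + n))))))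
  eq = solve-∀

bound-BCBC : ∀ n f m f₁ fₘ fₛ → m ≡ suc (suc n) → f₁ ≡ suc n * f → fₘ ≡ m * f₁ → fₛ ≡ suc m * fₘ →
  suc (2 * m) * (fₘ * (fₘ * (fₛ * 1))) ≤ m * (f * (f * (fₛ * (2 * m * suc n * suc n * (1 + m)))))
bound-BCBC n f m f₁ fₘ fₛ refl refl refl refl = ≤-trans (m≤m+n _ _) (≤-reflexive (eq n f))
  where
  eq : ∀ n f → (1 + 2 * (2 + n))
      * (((2 + n) * ((1 + n) * f))
      * (((2 + n) * ((1 + n) * f)) * (((1 + (2 + n)) * ((2 + n) * ((1 + n) * f))) * 1)))
      + ((2 + n) * ((1 + n) * f))
      * (((2 + n) * ((1 + n) * f)) * (((1 + (2 + n)) * ((2 + n) * ((1 + n) * f))) * 1))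
    ≡ (2 + n) * (f * (f *
        (((1 + (2 + n)) * ((2 + n) * ((1 + n) * f))) * (2 * (2 + n) * (1 + n) * (1 + n) * (1 + (2 + n))))))
  eq = solve-∀

module Upper (n : ℕ) where

  m : ℕ
  m = suc (suc n)

  open Vertices m
  open Order m

  orders : List (Permutation′ (suc m + m + m))
  orders = concatMap (λ α → concatMap (λ β → map (order α β) (perms m)) (perms m)) (perms (suc m))

  total-orders : ∀ F → total orders F ≡
    total (perms (suc m)) λ α → total (perms m) λ β → total (perms m) λ γ → F (order α β γ)
  total-orders F = trans
    (total-concatMap (λ α → concatMap (λ β → map (order α β) (perms m)) (perms m)) (perms (suc m)) F)
    (total-cong (perms (suc m)) λ α → trans
      (total-concatMap (λ β → map (order α β) (perms m)) (perms m) F)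
      (total-cong (perms m) λ β → total-map (order α β) (perms m) F))

  length-orders : length orders ≡ m ! * (m ! * (suc m ! * 1))
  length-orders = trans (length-total orders) (trans (total-orders (λ _ → 1))
    (total³ (perms (suc m)) (perms m) (perms m) (λ _ _ _ → 1) (λ _ _ → 1) (λ _ → 1) 1 (suc m !) (m !) (m !)
      (λ _ _ → total-perms-const m 1) (λ _ → total-perms-const m 1) (total-perms-const (suc m) 1)))

  countSep-orders : ∀ u v x y (P : Permutation′ (suc m) → Permutation′ m → Permutation′ m → ℕ) →
    (∀ α β γ → 𝟙 (separates (order α β γ) u v x y) ≡ P α β γ) →
    countSep orders u v x y ≡ total (perms (suc m)) λ α → total (perms m) λ β → total (perms m) λ γ → P α β γ
  countSep-orders u v x y P eq = trans (countSep-total orders u v x y) (trans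
    (total-orders λ σ → 𝟙 (separates σ u v x y))
    (total-cong (perms (suc m)) λ α → total-cong (perms m) λ β → total-cong (perms m) λ γ → eq α β γ))

  sep-cong : ∀ {p q r s p′ q′ r′ s′} → p ≡ p′ → q ≡ q′ → r ≡ r′ → s ≡ s′ →
    𝟙 (separated p q r s) ≡ 𝟙 (separated p′ q′ r′ s′)
  sep-cong refl refl refl refl = refl

  eA : Fin (suc m) → ℕ
  eA = slotA

  eB eC : Fin m → ℕ
  eB = slotB
  eC = slotC

  wA wB wC : Fin (suc (m * 3)) → ℕ
  wA = χ A ∘ toℕ
  wB = χ B ∘ toℕ
  wC = χ C ∘ toℕ

  rA : Realises eA wA
  rA = realises-slotA m

  rB : Realises eB wB
  rB = realises-slotB m

  rC : Realises eC wC
  rC = realises-slotC m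

  -- A part of size s containing j vertices of the pair contributes the factor (s - j)!, the number
  -- of its permutations with j prescribed images. With m = n + 2 this is (n + 1)! for each of the
  -- three parts here; the other types differ only in these factors.
  count-ABAC : ∀ i j i′ l → i ≢ i′ → countSep orders (vA i) (vB j) (vA i′) (vC l)
    ≡ suc n ! * (suc n ! * (suc n ! * (scanWord A B A C m 0 + scanWord A C A B m 0)))
  count-ABAC i j i′ l i≢i′ = begin
    countSep orders (vA i) (vB j) (vA i′) (vC l)
      ≡⟨ countSep-orders (vA i) (vB j) (vA i′) (vC l) F
           (λ α β γ → sep-cong (pos-vA α β γ i) (pos-vB α β γ j) (pos-vA α β γ i′) (pos-vC α β γ l)) ⟩
    total (perms (suc m)) (λ α → total (perms m) λ β → total (perms m) (F α β))
      ≡⟨ total³ (perms (suc m)) (perms m) (perms m) F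
           (λ α β → sum (T (α ⟨$⟩ʳ i) (β ⟨$⟩ʳ j) (α ⟨$⟩ʳ i′)))
           (λ α → sum λ q → sum (T (α ⟨$⟩ʳ i) q (α ⟨$⟩ʳ i′)))
           (sum λ p → sum λ r → sum λ q → sum λ s → T p q r s) (suc n !) (suc n !) (suc n !)
           (λ α β → total-perms₁ (suc n) (T (α ⟨$⟩ʳ i) (β ⟨$⟩ʳ j) (α ⟨$⟩ʳ i′)) l)
           (λ α → total-perms₁ (suc n) (λ q → sum (T (α ⟨$⟩ʳ i) q (α ⟨$⟩ʳ i′))) j)
           (total-perms₂ (suc n) (λ p r → sum λ q → sum (T p q r))
             (λ p → sum-zero (λ q → sum (T p q p)) λ q → sum-zero (T p q p) λ s →
               separated-13 (slotA p) (slotB q) (slotC s)) i i′ i≢i′) ⟩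
    suc n ! * (suc n ! * (suc n ! * (sum λ p → sum λ r → sum λ q → sum λ s → T p q r s)))
      ≡⟨ cong (λ x → suc n ! * (suc n ! * (suc n ! * x))) (trans
           (sum₄-comm T)
           (sum₄-separated eA eB eA eC wA wB wA wC rA rB rA rC)) ⟩
    suc n ! * (suc n ! * (suc n ! * (scanWord A B A C m 0 + scanWord A C A B m 0))) ∎
    where
    T : Fin (suc m) → Fin (m) → Fin (suc m) → Fin (m) → ℕ
    T p q r s = 𝟙 (separated (eA p) (eB q) (eA r) (eC s))
    F : Permutation′ (suc m) → Permutation′ m → Permutation′ m → ℕ
    F α β γ = T (α ⟨$⟩ʳ i) (β ⟨$⟩ʳ j) (α ⟨$⟩ʳ i′) (γ ⟨$⟩ʳ l)

  count-ABBC : ∀ i j j′ l → j ≢ j′ → countSep orders (vA i) (vB j) (vB j′) (vC l)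
    ≡ suc n ! * (n ! * (m ! * (scanWord A B B C m 0 + scanWord B C A B m 0)))
  count-ABBC i j j′ l j≢j′ = begin
    countSep orders (vA i) (vB j) (vB j′) (vC l)
      ≡⟨ countSep-orders (vA i) (vB j) (vB j′) (vC l) F
           (λ α β γ → sep-cong (pos-vA α β γ i) (pos-vB α β γ j) (pos-vB α β γ j′) (pos-vC α β γ l)) ⟩
    total (perms (suc m)) (λ α → total (perms m) λ β → total (perms m) (F α β))
      ≡⟨ total³ (perms (suc m)) (perms m) (perms m) F
           (λ α β → sum (T (α ⟨$⟩ʳ i) (β ⟨$⟩ʳ j) (β ⟨$⟩ʳ j′)))
           (λ α → sum λ q → sum λ r → sum (T (α ⟨$⟩ʳ i) q r))
           (sum₄ T) (m !) (n !) (suc n !)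
           (λ α β → total-perms₁ (suc n) (T (α ⟨$⟩ʳ i) (β ⟨$⟩ʳ j) (β ⟨$⟩ʳ j′)) l)
           (λ α → total-perms₂ n (λ q r → sum (T (α ⟨$⟩ʳ i) q r))
             (λ q → sum-zero (T (α ⟨$⟩ʳ i) q q) λ s →
                 separated-23 (slotB q) (slotA (α ⟨$⟩ʳ i)) (slotC s)) j j′ j≢j′)
           (total-perms₁ m (λ p → sum λ q → sum λ r → sum (T p q r)) i) ⟩
    suc n ! * (n ! * (m ! * (sum₄ T)))
      ≡⟨ cong (λ x → suc n ! * (n ! * (m ! * x))) (sum₄-separated eA eB eB eC wA wB wB wC rA rB rB rC) ⟩
    suc n ! * (n ! * (m ! * (scanWord A B B C m 0 + scanWord B C A B m 0))) ∎
    where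
    T : Fin (suc m) → Fin (m) → Fin (m) → Fin (m) → ℕ
    T p q r s = 𝟙 (separated (eA p) (eB q) (eB r) (eC s))
    F : Permutation′ (suc m) → Permutation′ m → Permutation′ m → ℕ
    F α β γ = T (α ⟨$⟩ʳ i) (β ⟨$⟩ʳ j) (β ⟨$⟩ʳ j′) (γ ⟨$⟩ʳ l)

  count-ACBC : ∀ i l j l′ → l ≢ l′ → countSep orders (vA i) (vC l) (vB j) (vC l′)
    ≡ n ! * (suc n ! * (m ! * (scanWord A C B C m 0 + scanWord B C A C m 0)))
  count-ACBC i l j l′ l≢l′ = begin
    countSep orders (vA i) (vC l) (vB j) (vC l′)
      ≡⟨ countSep-orders (vA i) (vC l) (vB j) (vC l′) F
           (λ α β γ → sep-cong (pos-vA α β γ i) (pos-vC α β γ l) (pos-vB α β γ j) (pos-vC α β γ l′)) ⟩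
    total (perms (suc m)) (λ α → total (perms m) λ β → total (perms m) (F α β))
      ≡⟨ total³ (perms (suc m)) (perms m) (perms m) F
           (λ α β → sum λ q → sum (T (α ⟨$⟩ʳ i) q (β ⟨$⟩ʳ j)))
           (λ α → sum λ r → sum λ q → sum (T (α ⟨$⟩ʳ i) q r))
           (sum λ p → sum λ r → sum λ q → sum λ s → T p q r s) (m !) (suc n !) (n !)
           (λ α β → total-perms₂ n (λ q s → T (α ⟨$⟩ʳ i) q (β ⟨$⟩ʳ j) s)
             (λ q → separated-24 (slotC q) (slotA (α ⟨$⟩ʳ i)) (slotB (β ⟨$⟩ʳ j))) l l′ l≢l′)
           (λ α → total-perms₁ (suc n) (λ r → sum λ q → sum (T (α ⟨$⟩ʳ i) q r)) j)
           (total-perms₁ m (λ p → sum λ r → sum λ q → sum (T p q r)) i) ⟩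
    n ! * (suc n ! * (m ! * (sum λ p → sum λ r → sum λ q → sum λ s → T p q r s)))
      ≡⟨ cong (λ x → n ! * (suc n ! * (m ! * x))) (trans
           (sum₄-comm T)
           (sum₄-separated eA eC eB eC wA wC wB wC rA rC rB rC)) ⟩
    n ! * (suc n ! * (m ! * (scanWord A C B C m 0 + scanWord B C A C m 0))) ∎
    where
    T : Fin (suc m) → Fin (m) → Fin (m) → Fin (m) → ℕ
    T p q r s = 𝟙 (separated (eA p) (eC q) (eB r) (eC s))
    F : Permutation′ (suc m) → Permutation′ m → Permutation′ m → ℕ
    F α β γ = T (α ⟨$⟩ʳ i) (γ ⟨$⟩ʳ l) (β ⟨$⟩ʳ j) (γ ⟨$⟩ʳ l′)

  count-ABAB : ∀ i j i′ j′ → i ≢ i′ → j ≢ j′ → countSep orders (vA i) (vB j) (vA i′) (vB j′)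
    ≡ m ! * (n ! * (suc n ! * (scanWord A B A B m 0 + scanWord A B A B m 0)))
  count-ABAB i j i′ j′ i≢i′ j≢j′ = begin
    countSep orders (vA i) (vB j) (vA i′) (vB j′)
      ≡⟨ countSep-orders (vA i) (vB j) (vA i′) (vB j′) F
           (λ α β γ → sep-cong (pos-vA α β γ i) (pos-vB α β γ j) (pos-vA α β γ i′) (pos-vB α β γ j′)) ⟩
    total (perms (suc m)) (λ α → total (perms m) λ β → total (perms m) (F α β))
      ≡⟨ total³ (perms (suc m)) (perms m) (perms m) F
           (λ α β → T (α ⟨$⟩ʳ i) (β ⟨$⟩ʳ j) (α ⟨$⟩ʳ i′) (β ⟨$⟩ʳ j′))
           (λ α → sum λ q → sum (T (α ⟨$⟩ʳ i) q (α ⟨$⟩ʳ i′)))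
           (sum λ p → sum λ r → sum λ q → sum λ s → T p q r s) (suc n !) (n !) (m !)
           (λ α β → total-perms-const m (T (α ⟨$⟩ʳ i) (β ⟨$⟩ʳ j) (α ⟨$⟩ʳ i′) (β ⟨$⟩ʳ j′)))
           (λ α → total-perms₂ n (λ q s → T (α ⟨$⟩ʳ i) q (α ⟨$⟩ʳ i′) s)
             (λ q → separated-24 (slotB q) (slotA (α ⟨$⟩ʳ i)) (slotA (α ⟨$⟩ʳ i′))) j j′ j≢j′)
           (total-perms₂ (suc n) (λ p r → sum λ q → sum (T p q r))
             (λ p → sum-zero (λ q → sum (T p q p)) λ q → sum-zero (T p q p) λ s →
               separated-13 (slotA p) (slotB q) (slotB s)) i i′ i≢i′) ⟩
    m ! * (n ! * (suc n ! * (sum λ p → sum λ r → sum λ q → sum λ s → T p q r s)))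
      ≡⟨ cong (λ x → m ! * (n ! * (suc n ! * x))) (trans
           (sum₄-comm T)
           (sum₄-separated eA eB eA eB wA wB wA wB rA rB rA rB)) ⟩
    m ! * (n ! * (suc n ! * (scanWord A B A B m 0 + scanWord A B A B m 0))) ∎
    where
    T : Fin (suc m) → Fin (m) → Fin (suc m) → Fin (m) → ℕ
    T p q r s = 𝟙 (separated (eA p) (eB q) (eA r) (eB s))
    F : Permutation′ (suc m) → Permutation′ m → Permutation′ m → ℕ
    F α β γ = T (α ⟨$⟩ʳ i) (β ⟨$⟩ʳ j) (α ⟨$⟩ʳ i′) (β ⟨$⟩ʳ j′)

  count-ACAC : ∀ i l i′ l′ → i ≢ i′ → l ≢ l′ → countSep orders (vA i) (vC l) (vA i′) (vC l′)
    ≡ n ! * (m ! * (suc n ! * (scanWord A C A C m 0 + scanWord A C A C m 0)))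
  count-ACAC i l i′ l′ i≢i′ l≢l′ = begin
    countSep orders (vA i) (vC l) (vA i′) (vC l′)
      ≡⟨ countSep-orders (vA i) (vC l) (vA i′) (vC l′) F
           (λ α β γ → sep-cong (pos-vA α β γ i) (pos-vC α β γ l) (pos-vA α β γ i′) (pos-vC α β γ l′)) ⟩
    total (perms (suc m)) (λ α → total (perms m) λ β → total (perms m) (F α β))
      ≡⟨ total³ (perms (suc m)) (perms m) (perms m) F
           (λ α β → sum λ q → sum (T (α ⟨$⟩ʳ i) q (α ⟨$⟩ʳ i′)))
           (λ α → sum λ q → sum (T (α ⟨$⟩ʳ i) q (α ⟨$⟩ʳ i′)))
           (sum λ p → sum λ r → sum λ q → sum λ s → T p q r s) (suc n !) (m !) (n !)
           (λ α β → total-perms₂ n (λ q s → T (α ⟨$⟩ʳ i) q (α ⟨$⟩ʳ i′) s)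
             (λ q → separated-24 (slotC q) (slotA (α ⟨$⟩ʳ i)) (slotA (α ⟨$⟩ʳ i′))) l l′ l≢l′)
           (λ α → total-perms-const m (sum λ q → sum (T (α ⟨$⟩ʳ i) q (α ⟨$⟩ʳ i′))))
           (total-perms₂ (suc n) (λ p r → sum λ q → sum (T p q r))
             (λ p → sum-zero (λ q → sum (T p q p)) λ q → sum-zero (T p q p) λ s →
               separated-13 (slotA p) (slotC q) (slotC s)) i i′ i≢i′) ⟩
    n ! * (m ! * (suc n ! * (sum λ p → sum λ r → sum λ q → sum λ s → T p q r s)))
      ≡⟨ cong (λ x → n ! * (m ! * (suc n ! * x))) (trans
           (sum₄-comm T)
           (sum₄-separated eA eC eA eC wA wC wA wC rA rC rA rC)) ⟩
    n ! * (m ! * (suc n ! * (scanWord A C A C m 0 + scanWord A C A C m 0))) ∎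
    where
    T : Fin (suc m) → Fin (m) → Fin (suc m) → Fin (m) → ℕ
    T p q r s = 𝟙 (separated (eA p) (eC q) (eA r) (eC s))
    F : Permutation′ (suc m) → Permutation′ m → Permutation′ m → ℕ
    F α β γ = T (α ⟨$⟩ʳ i) (γ ⟨$⟩ʳ l) (α ⟨$⟩ʳ i′) (γ ⟨$⟩ʳ l′)

  count-BCBC : ∀ j l j′ l′ → j ≢ j′ → l ≢ l′ → countSep orders (vB j) (vC l) (vB j′) (vC l′)
    ≡ n ! * (n ! * (suc m ! * (scanWord B C B C m 0 + scanWord B C B C m 0)))
  count-BCBC j l j′ l′ j≢j′ l≢l′ = begin
    countSep orders (vB j) (vC l) (vB j′) (vC l′)
      ≡⟨ countSep-orders (vB j) (vC l) (vB j′) (vC l′) F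
           (λ α β γ → sep-cong (pos-vB α β γ j) (pos-vC α β γ l) (pos-vB α β γ j′) (pos-vC α β γ l′)) ⟩
    total (perms (suc m)) (λ α → total (perms m) λ β → total (perms m) (F α β))
      ≡⟨ total³ (perms (suc m)) (perms m) (perms m) F
           (λ α β → sum λ q → sum (T (β ⟨$⟩ʳ j) q (β ⟨$⟩ʳ j′)))
           (λ α → sum λ p → sum λ r → sum λ q → sum λ s → T p q r s)
           (sum λ p → sum λ r → sum λ q → sum λ s → T p q r s) (suc m !) (n !) (n !)
           (λ α β → total-perms₂ n (λ q s → T (β ⟨$⟩ʳ j) q (β ⟨$⟩ʳ j′) s)
             (λ q → separated-24 (slotC q) (slotB (β ⟨$⟩ʳ j)) (slotB (β ⟨$⟩ʳ j′))) l l′ l≢l′)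
           (λ α → total-perms₂ n (λ p r → sum λ q → sum (T p q r))
             (λ p → sum-zero (λ q → sum (T p q p)) λ q → sum-zero (T p q p) λ s →
               separated-13 (slotB p) (slotC q) (slotC s)) j j′ j≢j′)
           (total-perms-const (suc m) (sum λ p → sum λ r → sum λ q → sum λ s → T p q r s)) ⟩
    n ! * (n ! * (suc m ! * (sum λ p → sum λ r → sum λ q → sum λ s → T p q r s)))
      ≡⟨ cong (λ x → n ! * (n ! * (suc m ! * x))) (trans
           (sum₄-comm T)
           (sum₄-separated eB eC eB eC wB wC wB wC rB rC rB rC)) ⟩
    n ! * (n ! * (suc m ! * (scanWord B C B C m 0 + scanWord B C B C m 0))) ∎
    where
    T : Fin (m) → Fin (m) → Fin (m) → Fin (m) → ℕ
    T p q r s = 𝟙 (separated (eB p) (eC q) (eB r) (eC s))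
    F : Permutation′ (suc m) → Permutation′ m → Permutation′ m → ℕ
    F α β γ = T (β ⟨$⟩ʳ j) (γ ⟨$⟩ʳ l) (β ⟨$⟩ʳ j′) (γ ⟨$⟩ʳ l′)

  -- The pair is separated by a fraction of at least (2m + 1)/(6m) of all orderings, with
  -- denominators cleared.
  Enough : (u v x y : V) → Set
  Enough u v x y = suc (2 * m) * length orders ≤ 6 * m * countSep orders u v x y

  enough : ∀ {u v x y} a b c S t → countSep orders u v x y ≡ c * (b * (a * S)) → 6 * S ≡ t →
    suc (2 * m) * (m ! * (m ! * (suc m ! * 1))) ≤ m * (c * (b * (a * t))) → Enough u v x y
  enough {u} {v} {x} {y} a b c S t count≡ 6S≡t bound = subst₂ _≤_
    (cong (suc (2 * m) *_) (sym length-orders))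
    (begin
      m * (c * (b * (a * t)))               ≡⟨ cong (λ t → m * (c * (b * (a * t)))) 6S≡t ⟨
      m * (c * (b * (a * (6 * S))))         ≡⟨ regroup m a b c S ⟩
      6 * m * (c * (b * (a * S)))           ≡⟨ cong (6 * m *_) count≡ ⟨
      6 * m * countSep orders u v x y ∎)
    bound
    where
    regroup : ∀ m a b c S → m * (c * (b * (a * (6 * S)))) ≡ 6 * m * (c * (b * (a * S)))
    regroup = solve-∀

  enough-ABAC : ∀ i j i′ l → i ≢ i′ → Enough (vA i) (vB j) (vA i′) (vC l)
  enough-ABAC i j i′ l i≢i′ =
    enough (suc n !) (suc n !) (suc n !) (scanWord A B A C m 0 + scanWord A C A B m 0)
        (m * m * (1 + m) * (1 + 2 * m))
      (count-ABAC i j i′ l i≢i′) (ABAC-total m)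
      (bound-ABAC n (n !) m (suc n !) (m !) (suc m !) refl refl refl refl)

  enough-ABBC : ∀ i j j′ l → j ≢ j′ → Enough (vA i) (vB j) (vB j′) (vC l)
  enough-ABBC i j j′ l j≢j′ =
    enough (m !) (n !) (suc n !) (scanWord A B B C m 0 + scanWord B C A B m 0)
        (m * suc n * (1 + m) * (1 + 2 * m))
      (count-ABBC i j j′ l j≢j′) (ABBC-total m (suc n) refl)
      (bound-ABBC n (n !) m (suc n !) (m !) (suc m !) refl refl refl refl)

  enough-ACBC : ∀ i l j l′ → l ≢ l′ → Enough (vA i) (vC l) (vB j) (vC l′)
  enough-ACBC i l j l′ l≢l′ =
    enough (m !) (suc n !) (n !) (scanWord A C B C m 0 + scanWord B C A C m 0)
        (m * suc n * (1 + m) * (1 + 2 * m))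
      (count-ACBC i l j l′ l≢l′) (ACBC-total m (suc n) refl)
      (bound-ACBC n (n !) m (suc n !) (m !) (suc m !) refl refl refl refl)

  enough-ABAB : ∀ i j i′ j′ → i ≢ i′ → j ≢ j′ → Enough (vA i) (vB j) (vA i′) (vB j′)
  enough-ABAB i j i′ j′ i≢i′ j≢j′ =
    enough (suc n !) (n !) (m !) (scanWord A B A B m 0 + scanWord A B A B m 0)
        (2 * m * suc n * (1 + m) * (1 + m))
      (count-ABAB i j i′ j′ i≢i′ j≢j′) (ABAB-total m (suc n) refl)
      (bound-ABAB n (n !) m (suc n !) (m !) (suc m !) refl refl refl refl)

  enough-ACAC : ∀ i l i′ l′ → i ≢ i′ → l ≢ l′ → Enough (vA i) (vC l) (vA i′) (vC l′)
  enough-ACAC i l i′ l′ i≢i′ l≢l′ =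
    enough (suc n !) (m !) (n !) (scanWord A C A C m 0 + scanWord A C A C m 0)
        (2 * m * suc n * (1 + m) * (1 + m))
      (count-ACAC i l i′ l′ i≢i′ l≢l′) (ACAC-total m (suc n) refl)
      (bound-ACAC n (n !) m (suc n !) (m !) (suc m !) refl refl refl refl)

  enough-BCBC : ∀ j l j′ l′ → j ≢ j′ → l ≢ l′ → Enough (vB j) (vC l) (vB j′) (vC l′)
  enough-BCBC j l j′ l′ j≢j′ l≢l′ =
    enough (suc m !) (n !) (n !) (scanWord B C B C m 0 + scanWord B C B C m 0)
        (2 * m * suc n * suc n * (1 + m))
      (count-BCBC j l j′ l′ j≢j′ l≢l′) (BCBC-total m (suc n) refl)
      (bound-BCBC n (n !) m (suc n !) (m !) (suc m !) refl refl refl refl)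

  -- Reduction of all nonincident pairs to the six types.

  data View : V → Set where
    inA : ∀ i → View (vA i)
    inB : ∀ i → View (vB i)
    inC : ∀ i → View (vC i)

  view : ∀ v → View v
  view v = subst View (join-splitAt (suc m + m) m v) (outer (splitAt (suc m + m) v))
    where
    inner : ∀ s → View (join (suc m) m s ↑ˡ m)
    inner (inj₁ i) = inA i
    inner (inj₂ i) = inB i
    outer : ∀ s → View (join (suc m + m) m s)
    outer (inj₁ w) = subst (λ w → View (w ↑ˡ m)) (join-splitAt (suc m) m w) (inner (splitAt (suc m) w))
    outer (inj₂ i) = inC i

  -- Fixing the order of the endpoints by their parts leaves nine combinations of two edges, and
  -- exchanging the edges leaves six.
  data Oriented : V → V → Set where
    ab : ∀ i j → Oriented (vA i) (vB j)
    ac : ∀ i l → Oriented (vA i) (vC l)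
    bc : ∀ j l → Oriented (vB j) (vC l)

  orient : ∀ u v → IsEdge (suc m) m m u v → Oriented u v ⊎ Oriented v u
  orient u v e with view u | view v
  ... | inA i | inA j = contradiction (trans (part-vA i) (sym (part-vA j))) e
  ... | inA i | inB j = inj₁ (ab i j)
  ... | inA i | inC j = inj₁ (ac i j)
  ... | inB i | inA j = inj₂ (ab j i)
  ... | inB i | inB j = contradiction (trans (part-vB i) (sym (part-vB j))) e
  ... | inB i | inC j = inj₁ (bc i j)
  ... | inC i | inA j = inj₂ (ac j i)
  ... | inC i | inB j = inj₂ (bc j i)
  ... | inC i | inC j = contradiction (trans (part-vC i) (sym (part-vC j))) e

  Enough-swapˡ : ∀ u v x y → Enough u v x y → Enough v u x y
  Enough-swapˡ u v x y = subst (λ c → suc (2 * m) * length orders ≤ 6 * m * c) (countSep-swapˡ orders u v x y)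

  Enough-swap : ∀ u v x y → Enough u v x y → Enough x y u v
  Enough-swap u v x y = subst (λ c → suc (2 * m) * length orders ≤ 6 * m * c) (countSep-swap orders u v x y)

  enough-oriented : ∀ {u v x y} → Oriented u v → Oriented x y → Nonincident u v x y → Enough u v x y
  enough-oriented (ab i j) (ab i′ j′) (u≢x , _ , _ , v≢y) =
      enough-ABAB i j i′ j′ (u≢x ∘ cong vA) (v≢y ∘ cong vB)
  enough-oriented (ab i j) (ac i′ l) (u≢x , _ , _ , _) = enough-ABAC i j i′ l (u≢x ∘ cong vA)
  enough-oriented (ab i j) (bc j′ l) (_ , _ , v≢x , _) = enough-ABBC i j j′ l (v≢x ∘ cong vB)
  enough-oriented (ac i l) (ab i′ j) (u≢x , _ , _ , _) =
    Enough-swap (vA i′) (vB j) (vA i) (vC l) (enough-ABAC i′ j i l (u≢x ∘ cong vA ∘ sym))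
  enough-oriented (ac i l) (ac i′ l′) (u≢x , _ , _ , v≢y) =
      enough-ACAC i l i′ l′ (u≢x ∘ cong vA) (v≢y ∘ cong vC)
  enough-oriented (ac i l) (bc j l′) (_ , _ , _ , v≢y) = enough-ACBC i l j l′ (v≢y ∘ cong vC)
  enough-oriented (bc j l) (ab i j′) (_ , u≢y , _ , _) =
    Enough-swap (vA i) (vB j′) (vB j) (vC l) (enough-ABBC i j′ j l (u≢y ∘ cong vB ∘ sym))
  enough-oriented (bc j l) (ac i l′) (_ , _ , _ , v≢y) =
    Enough-swap (vA i) (vC l′) (vB j) (vC l) (enough-ACBC i l′ j l (v≢y ∘ cong vC ∘ sym))
  enough-oriented (bc j l) (bc j′ l′) (u≢x , _ , _ , v≢y) =
      enough-BCBC j l j′ l′ (u≢x ∘ cong vB) (v≢y ∘ cong vC)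

  enough-halfOriented : ∀ u v x y → IsEdge (suc m) m m u v → Oriented x y → Nonincident u v x y →
      Enough u v x y
  enough-halfOriented u v x y e o (u≢x , u≢y , v≢x , v≢y) = [
    (λ uv → enough-oriented uv o (u≢x , u≢y , v≢x , v≢y)) ,
    (λ vu → Enough-swapˡ v u x y (enough-oriented vu o (v≢x , v≢y , u≢x , u≢y))) ]′ (orient u v e)

  enough-edges : ∀ u v x y → IsEdge (suc m) m m u v → IsEdge (suc m) m m x y → Nonincident u v x y →
      Enough u v x y
  enough-edges u v x y e e′ (u≢x , u≢y , v≢x , v≢y) = [
    (λ xy → enough-halfOriented u v x y e xy (u≢x , u≢y , v≢x , v≢y)) ,
    -- The endpoints of the second edge are exchanged by making it the first edge and back.
    (λ yx → Enough-swap x y u v (Enough-swapˡ y x u v (Enough-swap u v y x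
      (enough-halfOriented u v y x e yx (u≢y , u≢x , v≢y , v≢x))))) ]′ (orient x y e′)

  -- `K * (6 * m)` copies of the whole list clear the denominator of the frequency, so the ratio of
  -- length to multiplicity is exactly 6m/(2m + 1); `K` makes the multiplicity as large as desired.
  canSep : ∀ K → CanSep (suc m) m m (K * (suc (2 * m) * length orders)) (K * (6 * m) * length orders)
  canSep K = concat (replicate (K * (6 * m)) orders) , length-replicate-concat (K * (6 * m)) orders ,
    λ u v x y e e′ ni → subst (K * (suc (2 * m) * length orders) ≤_)
      (trans (sym (*-assoc K (6 * m) (countSep orders u v x y)))
          (sym (countSep-replicate (K * (6 * m)) orders u v x y)))
      (*-monoʳ-≤ K (enough-edges u v x y e e′ ni))

  1≤length-orders : 1 ≤ length orders
  1≤length-orders = subst (1 ≤_) (sym length-orders)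
    (*-mono-≤ (1≤n! m) (*-mono-≤ (1≤n! m) (*-mono-≤ (1≤n! (suc m)) ≤-refl)))

-- The two inequalities for the limit inferior.

canSep⇒≤ : ∀ n t k → let m = suc (suc n) in CanSep (suc m) m m t k → 6 * m * t ≤ k * suc (2 * m)
-- The cancelled factor is positive since m ≥ 2 makes m - 1 = `suc n` positive.
canSep⇒≤ n t k (L , refl , tsep) = *-cancelʳ-≤ (6 * m * t) (length L * suc (2 * m)) (m * m * suc n * 6)
  (subst (_≤ length L * suc (2 * m) * (m * m * suc n * 6)) (comm (6 * m) (m * m * suc n * 6) t)
    (separating-bound {t} {L} tsep))
  where
  open Lower (suc n)
  comm : ∀ x y z → x * y * z ≡ x * z * y
  comm = solve-∀

mainTheorem12 : (m : ℕ) → 2 ≤ m →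
    ((ε : ℚ) → 0ℚ < ε → Σ ℕ λ N → (t : ℕ) → t ≥ N → t ≥ 1 → (k : ℕ) →
    CanSep (suc m) m m t k → ((+ (6 * m)) / suc (2 * m)) -ℚ ε ≤ℚ ratio k t)
    ×
    ((ε : ℚ) → 0ℚ < ε → (N : ℕ) → Σ ℕ λ t → (t ≥ N) × (t ≥ 1) × Σ ℕ λ k →
    CanSep (suc m) m m t k × (ratio k t ≤ℚ ((+ (6 * m)) / suc (2 * m)) +ℚ ε))
mainTheorem12 (suc (suc n)) (s≤s (s≤s z≤n)) = lower , upper
  where
  open Upper n using (m; orders; canSep; 1≤length-orders)
  limit : ℚ
  limit = (+ (6 * m)) / suc (2 * m)
  lower : (ε : ℚ) → 0ℚ < ε → Σ ℕ λ N → (t : ℕ) → t ≥ N → t ≥ 1 → (k : ℕ) →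
    CanSep (suc m) m m t k → limit -ℚ ε ≤ℚ ratio k t
  -- The bound holds without error term for every `t ≥ 1`, so 0 serves as threshold.
  lower ε 0<ε = 0 , λ t _ t≥1 k sep →
    ℚ.≤-trans (p-ε≤p limit ε 0<ε) (ratio-≥ (6 * m) (2 * m) k t t≥1 (canSep⇒≤ n t k sep))
  upper : (ε : ℚ) → 0ℚ < ε → (N : ℕ) → Σ ℕ λ t → (t ≥ N) × (t ≥ 1) × Σ ℕ λ k →
    CanSep (suc m) m m t k × (ratio k t ≤ℚ limit +ℚ ε)
  -- Taking `suc N` as the multiplier makes `t` exceed `N` and stay positive even for `N = 0`.
  upper ε 0<ε N = t , ≤-trans (n≤1+n N) N<t , ≤-trans (s≤s z≤n) N<t , k , canSep (suc N) ,
    ℚ.≤-trans (ratio-≤ (6 * m) (2 * m) k t (≤-trans (s≤s z≤n) N<t)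
      (≤-reflexive (exchange (suc N) (6 * m) (length orders) (suc (2 * m))))) (p≤p+ε limit ε 0<ε)
    where
    t = suc N * (suc (2 * m) * length orders)
    k = suc N * (6 * m) * length orders
    N<t : suc N ≤ t
    N<t = subst (_≤ t) (*-identityʳ (suc N))
      (*-monoʳ-≤ (suc N) (*-mono-≤ (s≤s (z≤n {2 * m})) 1≤length-orders))
    exchange : ∀ x y l z → x * y * l * z ≡ y * (x * (z * l))
    exchange = solve-∀
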